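{- Let $p>2$ be a prime, let $\mathbb{K}$ be a cyclic number field of degree $p$ (that is, $\mathbb{K}/\mathbb{Q}$ is Galois with cyclic Galois group of order $p$), with ring of integers $\mathcal{O}_{\mathbb{K}}$, let $\theta$ be a generator of $\mathrm{Gal}(\mathbb{K}/\mathbb{Q})$, and let $\sigma:\mathbb{K}\to\mathbb{R}^p$ be the canonical embedding. Let $\alpha\in\mathcal{O}_{\mathbb{K}}\setminus\mathbb{Z}$. Then $Tr_{\mathbb{K}}(\alpha)\neq 0$ if and only if the set $\{\sigma(\alpha),\sigma(\theta(\alpha)),\ldots,\sigma(\theta^{p-1}(\alpha))\}$ is an $\mathbb{R}$-linearly independent subset of $\mathbb{R}^p$.
   Context: The field $\mathbb{K}$ is totally real and is regarded as a subfield of $\mathbb{R}$. $Tr_{\mathbb{K}}(\alpha)=\sum_{i=0}^{p-1}\theta^i(\alpha)$ is the trace from $\mathbb{K}$ to $\mathbb{Q}$. The canonical embedding is $\sigma(x)=(x,\theta(x),\theta^2(x),\ldots,\theta^{p-1}(x))$ for $x\in\mathbb{K}$. -}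

module Defs where

open import Algebra.Bundles using (CommutativeRing; Ring; Semiring)
import Algebra.Definitions.RawMonoid as RawMonoidDefs
import Algebra.Definitions.RawSemiring as RawSemiringDefs
open import Algebra.Module.Bundles using (LeftModule)
open import Algebra.Morphism.Structures
  using (IsRingHomomorphism; IsRingMonomorphism; IsRingIsomorphism)
open import Algebra.Structures using (IsCommutativeRing)
open import Data.Fin.Base using (Fin; toℕ)
open import Data.Integer.Base using (ℤ)
open import Data.Nat.Base as ℕ using (ℕ)
open import Data.Nat.GeneralisedArithmetic using (fold)
import Data.Nat.Properties as ℕ
open import Data.Product.Base using (∃; _×_; _,_)
open import Data.Rational.Base as ℚ using (ℚ; 0ℚ; 1ℚ; ½)
import Data.Rational.Properties as ℚ
open import Data.Rational.Solver using (module +-*-Solver)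
open import Data.Vec.Functional using (Vector)
open import Function.Bundles using (Inverse)
open import Function.Definitions using (Injective)
open import Level using (0ℓ; suc; _⊔_)
open import Relation.Binary.Bundles using (Setoid)
open import Relation.Binary.PropositionalEquality
  using (_≡_; refl; sym; trans; cong; subst)
import Relation.Binary.PropositionalEquality.Properties as ≡
open import Relation.Unary using (Pred; _∈_)

-- Real numbers: Cauchy sequences of rationals, identified when their
-- difference is a null sequence.

dist : ℚ → ℚ → ℚ
dist x y = ℚ.∣ x ℚ.- y ∣

IsCauchy : (ℕ → ℚ) → Set
IsCauchy s = ∀ ε → 0ℚ ℚ.< ε →
  ∃ λ N → ∀ m n → N ℕ.≤ m → N ℕ.≤ n → dist (s m) (s n) ℚ.< ε

record ℝ : Set where
  constructor mkℝ
  field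
    seq    : ℕ → ℚ
    cauchy : IsCauchy seq

open ℝ public

infix 4 _≃_

record _≃_ (x y : ℝ) : Set where
  constructor mk≃
  field
    close : ∀ ε → 0ℚ ℚ.< ε →
            ∃ λ N → ∀ n → N ℕ.≤ n → dist (seq x n) (seq y n) ℚ.< ε

open _≃_ public

private
  half+half : ∀ ε → ε ℚ.* ½ ℚ.+ ε ℚ.* ½ ≡ ε
  half+half ε = trans (sym (ℚ.*-distribˡ-+ ε ½ ½)) (ℚ.*-identityʳ ε)

  0<half : ∀ {ε} → 0ℚ ℚ.< ε → 0ℚ ℚ.< ε ℚ.* ½
  0<half {ε} 0<ε = ℚ.positive⁻¹ (ε ℚ.* ½) {{ℚ.pos*pos⇒pos ε {{ℚ.positive 0<ε}} ½}}

  dist-refl : ∀ x → dist x x ≡ 0ℚ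
  dist-refl x = cong ℚ.∣_∣ (ℚ.+-inverseʳ x)

  dist-sym : ∀ x y → dist x y ≡ dist y x
  dist-sym x y = trans (sym (ℚ.∣-p∣≡∣p∣ (x ℚ.- y))) (cong ℚ.∣_∣ (lemma x y))
    where
    open +-*-Solver
    lemma : ∀ x y → ℚ.- (x ℚ.- y) ≡ y ℚ.- x
    lemma = solve 2 (λ x y → :- (x :- y) := y :- x) refl

  dist-neg : ∀ x y → dist (ℚ.- x) (ℚ.- y) ≡ dist x y
  dist-neg x y = trans (cong ℚ.∣_∣ (lemma x y)) (ℚ.∣-p∣≡∣p∣ (x ℚ.- y))
    where
    open +-*-Solver
    lemma : ∀ x y → ℚ.- x ℚ.- ℚ.- y ≡ ℚ.- (x ℚ.- y)
    lemma = solve 2 (λ x y → (:- x) :- (:- y) := :- (x :- y)) refl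

  halves : ∀ {u v ε} → u ℚ.< ε ℚ.* ½ → v ℚ.< ε ℚ.* ½ → u ℚ.+ v ℚ.< ε
  halves {ε = ε} u< v< = subst (_ ℚ.<_) (half+half ε) (ℚ.+-mono-< u< v<)

  dist-trans : ∀ x y z {ε} → dist x y ℚ.< ε ℚ.* ½ → dist y z ℚ.< ε ℚ.* ½ →
               dist x z ℚ.< ε
  dist-trans x y z xy yz =
    ℚ.≤-<-trans
      (subst (λ t → ℚ.∣ t ∣ ℚ.≤ dist x y ℚ.+ dist y z) (lemma x y z)
             (ℚ.∣p+q∣≤∣p∣+∣q∣ (x ℚ.- y) (y ℚ.- z)))
      (halves xy yz)
    where
    open +-*-Solver
    lemma : ∀ x y z → (x ℚ.- y) ℚ.+ (y ℚ.- z) ≡ x ℚ.- z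
    lemma = solve 3 (λ x y z → (x :- y) :+ (y :- z) := x :- z) refl

  dist-+ : ∀ a b c d {ε} → dist a c ℚ.< ε ℚ.* ½ → dist b d ℚ.< ε ℚ.* ½ →
           dist (a ℚ.+ b) (c ℚ.+ d) ℚ.< ε
  dist-+ a b c d ac bd =
    ℚ.≤-<-trans
      (subst (λ t → ℚ.∣ t ∣ ℚ.≤ dist a c ℚ.+ dist b d) (lemma a b c d)
             (ℚ.∣p+q∣≤∣p∣+∣q∣ (a ℚ.- c) (b ℚ.- d)))
      (halves ac bd)
    where
    open +-*-Solver
    lemma : ∀ a b c d → (a ℚ.- c) ℚ.+ (b ℚ.- d) ≡ (a ℚ.+ b) ℚ.- (c ℚ.+ d)
    lemma = solve 4 (λ a b c d → (a :- c) :+ (b :- d) := (a :+ b) :- (c :+ d)) refl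

  abs-*-< : ∀ x y {M δ} → 0ℚ ℚ.< M → ℚ.∣ x ∣ ℚ.< M → ℚ.∣ y ∣ ℚ.< δ →
            ℚ.∣ x ℚ.* y ∣ ℚ.< M ℚ.* δ
  abs-*-< x y {M} {δ} 0<M x< y< = begin-strict
    ℚ.∣ x ℚ.* y ∣        ≡⟨ ℚ.∣p*q∣≡∣p∣*∣q∣ x y ⟩
    ℚ.∣ x ∣ ℚ.* ℚ.∣ y ∣  ≤⟨ ℚ.*-monoʳ-≤-nonNeg ℚ.∣ y ∣ {{ℚ.∣-∣-nonNeg y}} (ℚ.<⇒≤ x<) ⟩
    M ℚ.* ℚ.∣ y ∣        <⟨ ℚ.*-monoʳ-<-pos M {{ℚ.positive 0<M}} y< ⟩
    M ℚ.* δ              ∎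
    where open ℚ.≤-Reasoning

  dist-* : ∀ a b c d {M L δ η ε} → 0ℚ ℚ.< M → 0ℚ ℚ.< L →
           ℚ.∣ a ∣ ℚ.< M → ℚ.∣ d ∣ ℚ.< L →
           dist b d ℚ.< δ → dist a c ℚ.< η →
           M ℚ.* δ ≡ ε ℚ.* ½ → L ℚ.* η ≡ ε ℚ.* ½ →
           dist (a ℚ.* b) (c ℚ.* d) ℚ.< ε
  dist-* a b c d 0<M 0<L a< d< bd ac Mδ Lη =
    ℚ.≤-<-trans
      (subst (λ t → ℚ.∣ t ∣ ℚ.≤ ℚ.∣ a ℚ.* (b ℚ.- d) ∣ ℚ.+ ℚ.∣ d ℚ.* (a ℚ.- c) ∣)
             (lemma a b c d)
             (ℚ.∣p+q∣≤∣p∣+∣q∣ (a ℚ.* (b ℚ.- d)) (d ℚ.* (a ℚ.- c))))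
      (halves (subst (_ ℚ.<_) Mδ (abs-*-< a (b ℚ.- d) 0<M a< bd))
              (subst (_ ℚ.<_) Lη (abs-*-< d (a ℚ.- c) 0<L d< ac)))
    where
    open +-*-Solver
    lemma : ∀ a b c d →
            a ℚ.* (b ℚ.- d) ℚ.+ d ℚ.* (a ℚ.- c) ≡ (a ℚ.* b) ℚ.- (c ℚ.* d)
    lemma = solve 4 (λ a b c d → a :* (b :- d) :+ d :* (a :- c) := (a :* b) :- (c :* d)) refl

  divide : ∀ M ε → 0ℚ ℚ.< M → 0ℚ ℚ.< ε → ∃ λ δ → 0ℚ ℚ.< δ × M ℚ.* δ ≡ ε ℚ.* ½
  divide M ε 0<M 0<ε = 1/M ℚ.* (ε ℚ.* ½) , 0<δ , eq
    where
    instance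
      M-pos : ℚ.Positive M
      M-pos = ℚ.positive 0<M
      M-nonZero : ℚ.NonZero M
      M-nonZero = ℚ.pos⇒nonZero M
    1/M = ℚ.1/ M
    0<δ : 0ℚ ℚ.< 1/M ℚ.* (ε ℚ.* ½)
    0<δ = ℚ.positive⁻¹ _
      {{ℚ.pos*pos⇒pos 1/M {{ℚ.1/pos⇒pos M}} (ε ℚ.* ½) {{ℚ.positive (0<half 0<ε)}}}}
    eq : M ℚ.* (1/M ℚ.* (ε ℚ.* ½)) ≡ ε ℚ.* ½
    eq = trans (sym (ℚ.*-assoc M 1/M (ε ℚ.* ½)))
         (trans (cong (ℚ._* (ε ℚ.* ½)) (ℚ.*-inverseʳ M)) (ℚ.*-identityˡ (ε ℚ.* ½)))

  bounded : ∀ x → ∃ λ M → 0ℚ ℚ.< M ×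
            ∃ λ N → ∀ n → N ℕ.≤ n → ℚ.∣ seq x n ∣ ℚ.< M
  bounded x with cauchy x 1ℚ (ℚ.positive⁻¹ 1ℚ)
  ... | N , h = ℚ.∣ xN ∣ ℚ.+ 1ℚ , 0<M , N , bound
    where
    xN = seq x N
    0<M : 0ℚ ℚ.< ℚ.∣ xN ∣ ℚ.+ 1ℚ
    0<M = ℚ.+-mono-≤-< (ℚ.0≤∣p∣ xN) (ℚ.positive⁻¹ 1ℚ)
    open +-*-Solver
    lemma : ∀ a b → b ℚ.+ (a ℚ.- b) ≡ a
    lemma = solve 2 (λ a b → b :+ (a :- b) := a) refl
    bound : ∀ n → N ℕ.≤ n → ℚ.∣ seq x n ∣ ℚ.< ℚ.∣ xN ∣ ℚ.+ 1ℚ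
    bound n N≤n =
      ℚ.≤-<-trans
        (subst (λ t → ℚ.∣ t ∣ ℚ.≤ ℚ.∣ xN ∣ ℚ.+ dist (seq x n) xN) (lemma (seq x n) xN)
               (ℚ.∣p+q∣≤∣p∣+∣q∣ xN (seq x n ℚ.- xN)))
        (ℚ.+-mono-≤-< (ℚ.≤-refl {ℚ.∣ xN ∣}) (h n N N≤n ℕ.≤-refl))

  ⊔ˡ : ∀ {a b n} → a ℕ.⊔ b ℕ.≤ n → a ℕ.≤ n
  ⊔ˡ {a} {b} = ℕ.m⊔n≤o⇒m≤o a b

  ⊔ʳ : ∀ {a b n} → a ℕ.⊔ b ℕ.≤ n → b ℕ.≤ n
  ⊔ʳ {a} {b} = ℕ.m⊔n≤o⇒n≤o a b

  pointwise : ∀ x y → (∀ n → seq x n ≡ seq y n) → x ≃ y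
  pointwise x y eq = mk≃ λ ε 0<ε → 0 , λ n _ →
    subst (ℚ._< ε)
      (sym (trans (cong (λ t → dist t (seq y n)) (eq n)) (dist-refl (seq y n)))) 0<ε

-- The convergence proofs are abstract only to keep conversion checking fast.
abstract
  const-cauchy : ∀ q → IsCauchy (λ _ → q)
  const-cauchy q ε 0<ε = 0 , λ _ _ _ _ → subst (ℚ._< ε) (sym (dist-refl q)) 0<ε

  +-cauchy : ∀ x y → IsCauchy (λ n → seq x n ℚ.+ seq y n)
  +-cauchy x y ε 0<ε =
    let (N  , f) = cauchy x (ε ℚ.* ½) (0<half 0<ε)
        (N′ , g) = cauchy y (ε ℚ.* ½) (0<half 0<ε)
    in N ℕ.⊔ N′ , λ m n p q →
       dist-+ (seq x m) (seq y m) (seq x n) (seq y n)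
         (f m n (⊔ˡ {N} {N′} p) (⊔ˡ {N} {N′} q))
         (g m n (⊔ʳ {N} {N′} p) (⊔ʳ {N} {N′} q))

  neg-cauchy : ∀ x → IsCauchy (λ n → ℚ.- seq x n)
  neg-cauchy x ε 0<ε = let (N , f) = cauchy x ε 0<ε in
    N , λ m n p q →
      subst (ℚ._< ε) (sym (dist-neg (seq x m) (seq x n))) (f m n p q)

  *-cauchy : ∀ x y → IsCauchy (λ n → seq x n ℚ.* seq y n)
  *-cauchy x y ε 0<ε =
    let (M , 0<M , A , x<) = bounded x
        (L , 0<L , B , y<) = bounded y
        (δ , 0<δ , Mδ)     = divide M ε 0<M 0<ε
        (η , 0<η , Lη)     = divide L ε 0<L 0<ε
        (C , g)            = cauchy y δ 0<δ
        (D , f)            = cauchy x η 0<η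
        ab≤ = ⊔ˡ {A ℕ.⊔ B} {C ℕ.⊔ D}
        cd≤ = ⊔ʳ {A ℕ.⊔ B} {C ℕ.⊔ D}
    in (A ℕ.⊔ B) ℕ.⊔ (C ℕ.⊔ D) , λ m n p q →
       dist-* (seq x m) (seq y m) (seq x n) (seq y n) 0<M 0<L
         (x< m (⊔ˡ {A} {B} (ab≤ p)))
         (y< n (⊔ʳ {A} {B} (ab≤ q)))
         (g m n (⊔ˡ {C} {D} (cd≤ p)) (⊔ˡ {C} {D} (cd≤ q)))
         (f m n (⊔ʳ {C} {D} (cd≤ p)) (⊔ʳ {C} {D} (cd≤ q)))
         Mδ Lη

infix  8 -ʳ_
infixl 7 _*ʳ_
infixl 6 _+ʳ_

fromℚ : ℚ → ℝ
fromℚ q = mkℝ (λ _ → q) (const-cauchy q)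

_+ʳ_ : ℝ → ℝ → ℝ
x +ʳ y = mkℝ (λ n → seq x n ℚ.+ seq y n) (+-cauchy x y)

-ʳ_ : ℝ → ℝ
-ʳ x = mkℝ (λ n → ℚ.- seq x n) (neg-cauchy x)

_*ʳ_ : ℝ → ℝ → ℝ
x *ʳ y = mkℝ (λ n → seq x n ℚ.* seq y n) (*-cauchy x y)

private
  ≃-refl : ∀ {x} → x ≃ x
  ≃-refl {x} = pointwise x x λ _ → refl

  ≃-sym : ∀ {x y} → x ≃ y → y ≃ x
  ≃-sym {x} {y} x≃y = mk≃ λ ε 0<ε → let (N , f) = close x≃y ε 0<ε in
    N , λ n N≤n → subst (ℚ._< ε) (dist-sym (seq x n) (seq y n)) (f n N≤n)

  ≃-trans : ∀ {x y z} → x ≃ y → y ≃ z → x ≃ z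
  ≃-trans {x} {y} {z} x≃y y≃z = mk≃ λ ε 0<ε →
    let (N  , f) = close x≃y (ε ℚ.* ½) (0<half 0<ε)
        (N′ , g) = close y≃z (ε ℚ.* ½) (0<half 0<ε)
    in N ℕ.⊔ N′ , λ n N≤n →
       dist-trans (seq x n) (seq y n) (seq z n)
         (f n (⊔ˡ {N} {N′} N≤n)) (g n (⊔ʳ {N} {N′} N≤n))

  +ʳ-cong : ∀ {x y u v} → x ≃ y → u ≃ v → x +ʳ u ≃ y +ʳ v
  +ʳ-cong {x} {y} {u} {v} x≃y u≃v = mk≃ λ ε 0<ε →
    let (N  , f) = close x≃y (ε ℚ.* ½) (0<half 0<ε)
        (N′ , g) = close u≃v (ε ℚ.* ½) (0<half 0<ε)
    in N ℕ.⊔ N′ , λ n N≤n →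
       dist-+ (seq x n) (seq u n) (seq y n) (seq v n)
         (f n (⊔ˡ {N} {N′} N≤n)) (g n (⊔ʳ {N} {N′} N≤n))

  -ʳ-cong : ∀ {x y} → x ≃ y → -ʳ x ≃ -ʳ y
  -ʳ-cong {x} {y} x≃y = mk≃ λ ε 0<ε → let (N , f) = close x≃y ε 0<ε in
    N , λ n N≤n → subst (ℚ._< ε) (sym (dist-neg (seq x n) (seq y n))) (f n N≤n)

  *ʳ-cong : ∀ {x y u v} → x ≃ y → u ≃ v → x *ʳ u ≃ y *ʳ v
  *ʳ-cong {x} {y} {u} {v} x≃y u≃v = mk≃ λ ε 0<ε →
    let (M , 0<M , A , x<) = bounded x
        (L , 0<L , B , v<) = bounded v
        (δ , 0<δ , Mδ)     = divide M ε 0<M 0<ε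
        (η , 0<η , Lη)     = divide L ε 0<L 0<ε
        (C , g)            = close u≃v δ 0<δ
        (D , f)            = close x≃y η 0<η
        ab≤ = ⊔ˡ {A ℕ.⊔ B} {C ℕ.⊔ D}
        cd≤ = ⊔ʳ {A ℕ.⊔ B} {C ℕ.⊔ D}
    in (A ℕ.⊔ B) ℕ.⊔ (C ℕ.⊔ D) , λ n p →
       dist-* (seq x n) (seq u n) (seq y n) (seq v n) 0<M 0<L
         (x< n (⊔ˡ {A} {B} (ab≤ p)))
         (v< n (⊔ʳ {A} {B} (ab≤ p)))
         (g n (⊔ˡ {C} {D} (cd≤ p)))
         (f n (⊔ʳ {C} {D} (cd≤ p)))
         Mδ Lη

  0ʳ 1ʳ : ℝ
  0ʳ = fromℚ 0ℚ
  1ʳ = fromℚ 1ℚ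

  +ʳ-assoc : ∀ x y z → (x +ʳ y) +ʳ z ≃ x +ʳ (y +ʳ z)
  +ʳ-assoc x y z = pointwise ((x +ʳ y) +ʳ z) (x +ʳ (y +ʳ z)) λ n →
    ℚ.+-assoc (seq x n) (seq y n) (seq z n)

  +ʳ-comm : ∀ x y → x +ʳ y ≃ y +ʳ x
  +ʳ-comm x y = pointwise (x +ʳ y) (y +ʳ x) λ n → ℚ.+-comm (seq x n) (seq y n)

  +ʳ-identityˡ : ∀ x → 0ʳ +ʳ x ≃ x
  +ʳ-identityˡ x = pointwise (0ʳ +ʳ x) x λ n → ℚ.+-identityˡ (seq x n)

  +ʳ-identityʳ : ∀ x → x +ʳ 0ʳ ≃ x
  +ʳ-identityʳ x = pointwise (x +ʳ 0ʳ) x λ n → ℚ.+-identityʳ (seq x n)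

  +ʳ-inverseˡ : ∀ x → (-ʳ x) +ʳ x ≃ 0ʳ
  +ʳ-inverseˡ x = pointwise ((-ʳ x) +ʳ x) 0ʳ λ n → ℚ.+-inverseˡ (seq x n)

  +ʳ-inverseʳ : ∀ x → x +ʳ (-ʳ x) ≃ 0ʳ
  +ʳ-inverseʳ x = pointwise (x +ʳ (-ʳ x)) 0ʳ λ n → ℚ.+-inverseʳ (seq x n)

  *ʳ-assoc : ∀ x y z → (x *ʳ y) *ʳ z ≃ x *ʳ (y *ʳ z)
  *ʳ-assoc x y z = pointwise ((x *ʳ y) *ʳ z) (x *ʳ (y *ʳ z)) λ n →
    ℚ.*-assoc (seq x n) (seq y n) (seq z n)

  *ʳ-comm : ∀ x y → x *ʳ y ≃ y *ʳ x
  *ʳ-comm x y = pointwise (x *ʳ y) (y *ʳ x) λ n → ℚ.*-comm (seq x n) (seq y n)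

  *ʳ-identityˡ : ∀ x → 1ʳ *ʳ x ≃ x
  *ʳ-identityˡ x = pointwise (1ʳ *ʳ x) x λ n → ℚ.*-identityˡ (seq x n)

  *ʳ-identityʳ : ∀ x → x *ʳ 1ʳ ≃ x
  *ʳ-identityʳ x = pointwise (x *ʳ 1ʳ) x λ n → ℚ.*-identityʳ (seq x n)

  *ʳ-distribˡ-+ʳ : ∀ x y z → x *ʳ (y +ʳ z) ≃ x *ʳ y +ʳ x *ʳ z
  *ʳ-distribˡ-+ʳ x y z = pointwise (x *ʳ (y +ʳ z)) (x *ʳ y +ʳ x *ʳ z) λ n →
    ℚ.*-distribˡ-+ (seq x n) (seq y n) (seq z n)

  *ʳ-distribʳ-+ʳ : ∀ x y z → (y +ʳ z) *ʳ x ≃ y *ʳ x +ʳ z *ʳ x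
  *ʳ-distribʳ-+ʳ x y z = pointwise ((y +ʳ z) *ʳ x) (y *ʳ x +ʳ z *ʳ x) λ n →
    ℚ.*-distribʳ-+ (seq x n) (seq y n) (seq z n)

  isCommutativeRing : IsCommutativeRing _≃_ _+ʳ_ _*ʳ_ -ʳ_ 0ʳ 1ʳ
  isCommutativeRing = record
    { isRing = record
      { +-isAbelianGroup = record
        { isGroup = record
          { isMonoid = record
            { isSemigroup = record
              { isMagma = record
                { isEquivalence = record
                  { refl = ≃-refl ; sym = ≃-sym ; trans = ≃-trans }
                ; ∙-cong = +ʳ-cong
                }
              ; assoc = +ʳ-assoc
              }
            ; identity = +ʳ-identityˡ , +ʳ-identityʳ
            }
          ; inverse = +ʳ-inverseˡ , +ʳ-inverseʳ
          ; ⁻¹-cong = -ʳ-cong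
          }
        ; comm = +ʳ-comm
        }
      ; *-cong = *ʳ-cong
      ; *-assoc = *ʳ-assoc
      ; *-identity = *ʳ-identityˡ , *ʳ-identityʳ
      ; distrib = *ʳ-distribˡ-+ʳ , *ʳ-distribʳ-+ʳ
      }
    ; *-comm = *ʳ-comm
    }

ℝ-commutativeRing : CommutativeRing 0ℓ 0ℓ
ℝ-commutativeRing = record { isCommutativeRing = isCommutativeRing }

ℚ-commutativeRing : CommutativeRing 0ℓ 0ℓ
ℚ-commutativeRing = ℚ.+-*-commutativeRing

infix 10 _^ᵐ_

_^ᵐ_ : ∀ {r ℓ} (R : Ring r ℓ) (n : ℕ) → LeftModule R r ℓ
R ^ᵐ n = record
  { Carrierᴹ = Vector Carrier n
  ; _≈ᴹ_ = λ u v → ∀ i → u i ≈ v i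
  ; _+ᴹ_ = λ u v i → u i + v i
  ; _*ₗ_ = λ a v i → a * v i
  ; 0ᴹ = λ _ → 0#
  ; -ᴹ_ = λ v i → - v i
  ; isLeftModule = record
    { isLeftSemimodule = record
      { +ᴹ-isCommutativeMonoid = record
        { isMonoid = record
          { isSemigroup = record
            { isMagma = record
              { isEquivalence = record
                { refl = λ _ → R.refl
                ; sym = λ p i → R.sym (p i)
                ; trans = λ p q i → R.trans (p i) (q i)
                }
              ; ∙-cong = λ p q i → +-cong (p i) (q i)
              }
            ; assoc = λ u v w i → +-assoc (u i) (v i) (w i)
            }
          ; identity = (λ v i → +-identityˡ (v i)) , (λ v i → +-identityʳ (v i))
          }
        ; comm = λ u v i → +-comm (u i) (v i)
        }
      ; isPreleftSemimodule = record
        { *ₗ-cong = λ p q i → *-cong p (q i)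
        ; *ₗ-zeroˡ = λ v i → zeroˡ (v i)
        ; *ₗ-distribʳ = λ v a b i → distribʳ (v i) a b
        ; *ₗ-identityˡ = λ v i → *-identityˡ (v i)
        ; *ₗ-assoc = λ a b v i → *-assoc a b (v i)
        ; *ₗ-zeroʳ = λ a i → zeroʳ a
        ; *ₗ-distribˡ = λ a u v i → distribˡ a (u i) (v i)
        }
      }
    ; -ᴹ‿cong = λ p i → -‿cong (p i)
    ; -ᴹ‿inverse = (λ v i → -‿inverseˡ (v i)) , (λ v i → -‿inverseʳ (v i))
    }
  }
  where
  module R = Ring R
  open R hiding (refl; sym; trans)

restrictScalars : ∀ {r ℓr s ℓs} (R : Ring r ℓr) (S : Ring s ℓs)
                  (f : Ring.Carrier R → Ring.Carrier S) →
                  IsRingHomomorphism (Ring.rawRing R) (Ring.rawRing S) f →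
                  LeftModule R s ℓs
restrictScalars R S f f-hom = record
  { Carrierᴹ = Carrier
  ; _≈ᴹ_ = _≈_
  ; _+ᴹ_ = _+_
  ; _*ₗ_ = λ a x → f a * x
  ; 0ᴹ = 0#
  ; -ᴹ_ = -_
  ; isLeftModule = record
    { isLeftSemimodule = record
      { +ᴹ-isCommutativeMonoid = +-isCommutativeMonoid
      ; isPreleftSemimodule = record
        { *ₗ-cong = λ p q → *-cong (F.⟦⟧-cong p) q
        ; *ₗ-zeroˡ = λ x → S.trans (*-congʳ F.0#-homo) (zeroˡ x)
        ; *ₗ-distribʳ = λ x a b → S.trans (*-congʳ (F.+-homo a b)) (distribʳ x (f a) (f b))
        ; *ₗ-identityˡ = λ x → S.trans (*-congʳ F.1#-homo) (*-identityˡ x)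
        ; *ₗ-assoc = λ a b x → S.trans (*-congʳ (F.*-homo a b)) (*-assoc (f a) (f b) x)
        ; *ₗ-zeroʳ = λ a → zeroʳ (f a)
        ; *ₗ-distribˡ = λ a x y → distribˡ (f a) x y
        }
      }
    ; -ᴹ‿cong = -‿cong
    ; -ᴹ‿inverse = -‿inverse
    }
  }
  where
  module S = Ring S
  module F = IsRingHomomorphism f-hom
  open S hiding (refl; sym; trans)

module _ {r ℓr m ℓm} {R : Ring r ℓr} (M : LeftModule R m ℓm) where
  open Ring R using (Carrier; _≈_; 0#)
  open LeftModule M using (Carrierᴹ; _≈ᴹ_; _*ₗ_; 0ᴹ; +ᴹ-rawMonoid)

  linearCombination : ∀ {n} → Vector Carrier n → Vector Carrierᴹ n → Carrierᴹ
  linearCombination c v = RawMonoidDefs.sum +ᴹ-rawMonoid (λ i → c i *ₗ v i)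

  IndependentFamily : ∀ {n} → Vector Carrierᴹ n → Set (r ⊔ ℓr ⊔ ℓm)
  IndependentFamily v =
    ∀ c → linearCombination c v ≈ᴹ 0ᴹ → ∀ i → c i ≈ 0#

  SpanningFamily : ∀ {n} → Vector Carrierᴹ n → Set (r ⊔ m ⊔ ℓm)
  SpanningFamily v = ∀ x → ∃ λ c → x ≈ᴹ linearCombination c v

  -- A subset is independent when any finitely many distinct elements of it are.
  IndependentSubset : ∀ {s} → Pred Carrierᴹ s → Set (r ⊔ ℓr ⊔ m ⊔ ℓm ⊔ s)
  IndependentSubset S =
    ∀ {n} (v : Vector Carrierᴹ n) → (∀ i → v i ∈ S) →
    Injective _≡_ _≈ᴹ_ v → IndependentFamily v

-- The library's HeytingField takes an apartness relation as extra data.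
-- Equality in a number field is decidable (compare coordinates in a
-- ℚ-basis), so the plain formulation loses nothing there.
record IsField {c ℓ} (R : CommutativeRing c ℓ) : Set (c ⊔ ℓ) where
  open CommutativeRing R
  field
    0≉1     : 0# ≉ 1#
    inverse : ∀ x → x ≉ 0# → ∃ λ y → x * y ≈ 1#

record NumberField (degree : ℕ) c ℓ : Set (suc (c ⊔ ℓ)) where
  field
    commutativeRing : CommutativeRing c ℓ
    isField         : IsField commutativeRing

  open CommutativeRing commutativeRing public

  field
    ι     : ℚ → Carrier
    ι-hom : IsRingHomomorphism (CommutativeRing.rawRing ℚ-commutativeRing) rawRing ι

  ℚ-module : LeftModule (CommutativeRing.ring ℚ-commutativeRing) c ℓ
  ℚ-module = restrictScalars (CommutativeRing.ring ℚ-commutativeRing) ring ι ι-hom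

  field
    basis             : Vector Carrier degree
    basis-independent : IndependentFamily ℚ-module basis
    basis-spanning    : SpanningFamily ℚ-module basis

module _ {n c ℓ} (K : NumberField n c ℓ) where
  open NumberField K
  open RawSemiringDefs (Semiring.rawSemiring semiring) using (_^_; sum)

  fromℤ : ℤ → Carrier
  fromℤ m = ι (m ℚ./ 1)

  ℤᴷ : Pred Carrier ℓ
  ℤᴷ α = ∃ λ m → α ≈ fromℤ m

  -- α is a root of a monic polynomial Xᵈ + Σᵢ aᵢ Xⁱ (i < d) over ℤ.
  𝓞 : Pred Carrier ℓ
  𝓞 α = ∃ λ d → ∃ λ (a : Vector ℤ d) →
        α ^ d + sum (λ i → fromℤ (a i) * α ^ toℕ i) ≈ 0#

  record Gal : Set (c ⊔ ℓ) where
    field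
      ⟦_⟧    : Carrier → Carrier
      isIso  : IsRingIsomorphism rawRing rawRing ⟦_⟧
      fixesℚ : ∀ q → ⟦ ι q ⟧ ≈ ι q

  open Gal

  Gal-setoid : Setoid (c ⊔ ℓ) (c ⊔ ℓ)
  Gal-setoid = record
    { Carrier = Gal
    ; _≈_ = λ σ τ → ∀ x → ⟦ σ ⟧ x ≈ ⟦ τ ⟧ x
    ; isEquivalence = record
      { refl = λ _ → NumberField.refl K
      ; sym = λ p x → NumberField.sym K (p x)
      ; trans = λ p q x → NumberField.trans K (p x) (q x)
      }
    }

  iter : Gal → ℕ → Carrier → Carrier
  iter θ k x = fold x ⟦ θ ⟧ k

  -- Non-negative powers suffice because the group is finite where this is used.
  Generates : Gal → Set (c ⊔ ℓ)
  Generates θ = ∀ τ → ∃ λ k → ∀ x → ⟦ τ ⟧ x ≈ iter θ k x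

  -- K/ℚ is finite, so being Galois means that the fixed field of Gal is ℚ.
  IsGalois : Set (c ⊔ ℓ)
  IsGalois = ∀ x → (∀ τ → ⟦ τ ⟧ x ≈ x) → ∃ λ q → x ≈ ι q

  -- `order` puts the Galois group in bijection with Fin n, where n = [K : ℚ].
  record IsCyclicGalois : Set (c ⊔ ℓ) where
    field
      isGalois  : IsGalois
      order     : Inverse (≡.setoid (Fin n)) Gal-setoid
      generator : ∃ Generates

  record RealEmbedding : Set (c ⊔ ℓ) where
    field
      embed  : Carrier → ℝ
      isMono : IsRingMonomorphism rawRing (CommutativeRing.rawRing ℝ-commutativeRing) embed

  -- The trace, as an element of (the image of ℚ in) K; meaningful when θ
  -- generates a Galois group of order n.
  Tr : Gal → Carrier → Carrier
  Tr θ α = sum {n} (λ i → iter θ (toℕ i) α)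

  canonicalEmbedding : RealEmbedding → Gal → Carrier → Vector ℝ n
  canonicalEmbedding e θ x i = RealEmbedding.embed e (iter θ (toℕ i) x)

ℝ^_ : (n : ℕ) → LeftModule (CommutativeRing.ring ℝ-commutativeRing) 0ℓ 0ℓ
ℝ^ n = CommutativeRing.ring ℝ-commutativeRing ^ᵐ n

conjugateVectors : ∀ {n c ℓ} (K : NumberField n c ℓ) → RealEmbedding K → Gal K →
                   NumberField.Carrier K → Pred (Vector ℝ n) 0ℓ
conjugateVectors {n} K e θ α v =
  ∃ λ (j : Fin n) → v ≈ᴹ canonicalEmbedding K e θ (iter K θ (toℕ j) α)
  where open LeftModule (ℝ^ n)

{-# OPTIONS --safe #-}
-- Write Δ = θ - 1 and β = Δα. An ℝ-relation between the conjugate vectors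
-- exists only if there is a K-relation, because a dual system over K stays
-- dual over ℝ. Untwisting a K-relation by the powers of θ and summing
-- makes its coefficients traces, hence rational, so one gets a nonzero integer
-- polynomial of degree < p in θ that kills α. Taking traces, Tr α ≠ 0 forces
-- its constant term in Δ to vanish, so an integer polynomial of degree < p - 1
-- kills β. On L = ℤ[θ]β the sum of the powers of θ vanishes, and binomial
-- expansion gives Δᵖ⁻¹ = - p (1 + Δ(…)), as in Eisenstein's criterion for the
-- cyclotomic polynomial. If β ∉ ΔL, this makes every coefficient of a relation
-- divisible by p, hence by all powers of p. If β ∈ ΔL, then L = pL, which is
-- impossible because x ↦ Tr (β⁻¹ x) has bounded denominators on L and is
-- nonzero at β. Finally β ≠ 0, since a rational algebraic integer is an integer.
-- Conversely, if Tr α = 0 then the conjugate vectors, which are distinct, sum to 0.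

module Submission where

open import Defs
open import Algebra.Bundles using (CommutativeRing; Semiring)
import Algebra.Definitions.RawSemiring as RawSemiringDefs
open import Algebra.Module.Bundles using (LeftModule)
import Algebra.Morphism.Construct.Composition as Composition
import Algebra.Morphism.Construct.Identity as Identity
open import Algebra.Morphism.Structures
  using (IsRingHomomorphism; IsRingIsomorphism; IsRingMonomorphism)
import Algebra.Properties.Ring as RingProperties
import Algebra.Properties.Semiring.Sum as SemiringSum
import Algebra.Solver.Ring as RingSolver
import Algebra.Solver.Ring.AlmostCommutativeRing as ACR
open import Data.Empty using (⊥; ⊥-elim)
open import Data.Fin.Base as Fin using (Fin; toℕ)
import Data.Fin.Properties as Fin
open import Data.Integer.Base as ℤ using (ℤ; +_; 0ℤ; 1ℤ; -1ℤ)
open import Data.Integer.Divisibility.Signed as ℤ∣ using (divides)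
import Data.Integer.Properties as ℤ
open import Data.Maybe.Base using (Maybe; just; nothing)
open import Data.Nat.Base as ℕ using (ℕ; zero; suc; _<_; _≤_; _!; _∸_; z≤n; s≤s)
open import Data.Nat.Combinatorics
  using (_C_; nC1≡n; nCn≡1; nCk+nC[k+1]≡[n+1]C[k+1]; k![n∸k]!∣n!)
open import Data.Nat.Combinatorics.Specification using (k>n⇒nCk≡0; nCk≡n!/k![n-k]!)
open import Data.Nat.Coprimality as Cop using (Coprime)
import Data.Nat.Divisibility as ℕ∣
open import Data.Nat.DivMod using (m/n*n≡m; m≡m%n+[m/n]*n; m%n<n)
open import Data.Nat.GCD using (module Bézout)
open import Data.Nat.GeneralisedArithmetic using (fold)
open import Data.Nat.Primality using (Prime; ¬prime[1]; euclidsLemma; prime⇒irreducible)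
import Data.Nat.Properties as ℕ
open import Data.Product.Base using (∃; ∃₂; _×_; _,_; proj₁; proj₂)
open import Data.Rational.Base as ℚ using (ℚ; mkℚ; ↥_; ↧_; ↧ₙ_)
import Data.Rational.Properties as ℚ
open import Data.Rational.Unnormalised.Base as ℚᵘ using (mkℚᵘ; *≡*)
import Data.Rational.Unnormalised.Properties as ℚᵘ
open import Data.Sum.Base using (_⊎_; inj₁; inj₂; [_,_]′)
open import Data.Vec.Functional using (Vector)
open import Function.Base using (_∘_)
open import Function.Bundles using (_⇔_; mk⇔; Inverse)
open import Function.Definitions using (Injective)
open import Level using (Level; _⊔_)
open import Relation.Binary.Bundles using (Setoid)
open import Relation.Binary.Definitions using (tri<; tri≈; tri>)
open import Relation.Binary.PropositionalEquality as ≡ using (_≡_; _≢_)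
import Relation.Binary.Reasoning.Setoid as SetoidReasoning
open import Relation.Nullary.Decidable using (Dec; yes; no; ¬?; decidable-stable; map′)
open import Relation.Nullary.Negation using (¬_)
open import Relation.Unary using (_∈_; _∉_)

-- Divisibility by a prime in the integers.

prime∤! : ∀ {p} → Prime p → ∀ k → k < p → ¬ (p ℕ∣.∣ k !)
prime∤! pr zero    0<p p∣1 = ¬prime[1] (≡.subst Prime (ℕ∣.∣1⇒≡1 p∣1) pr)
prime∤! pr (suc k) k<p p∣  with euclidsLemma (suc k) (k !) pr p∣
... | inj₁ p∣k = ℕ.<⇒≱ k<p (ℕ∣.∣⇒≤ p∣k)
... | inj₂ p∣! = prime∤! pr k (ℕ.<-trans (ℕ.n<1+n k) k<p) p∣!

-- `p` divides `p !`, which is the binomial coefficient times `k ! * (p ∸ k) !`. Both factorials are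
-- of numbers below `p`, so Euclid's lemma leaves only the coefficient.
prime∣C : ∀ {p} → Prime p → ∀ k → 0 < k → k < p → p ℕ∣.∣ p C k
prime∣C {p@(suc p-1)} pr k 0<k k<p
  with euclidsLemma (p C k) (k ! ℕ.* (p ∸ k) !) pr
         (≡.subst (p ℕ∣.∣_) (≡.sym C*) (ℕ∣.m∣m*n (p-1 !)))
  where
  k≤p = ℕ.<⇒≤ k<p
  instance _ = k ℕ.!* (p ∸ k) !≢0
  C* : (p C k) ℕ.* (k ! ℕ.* (p ∸ k) !) ≡ p !
  C* = ≡.trans (≡.cong (ℕ._* (k ! ℕ.* (p ∸ k) !)) (nCk≡n!/k![n-k]! k≤p))
             (m/n*n≡m (k![n∸k]!∣n! k≤p))
... | inj₁ p∣C = p∣C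
... | inj₂ p∣d with euclidsLemma (k !) ((p ∸ k) !) pr p∣d
...   | inj₁ p∣k! = ⊥-elim (prime∤! pr k k<p p∣k!)
...   | inj₂ p∣k! = ⊥-elim (prime∤! pr (p ∸ k) (ℕ.∸-monoʳ-< 0<k (ℕ.<⇒≤ k<p)) p∣k!)

prime-bézout : ∀ {p} → Prime p → ∀ z → ¬ (+ p ℤ∣.∣ z) →
               ∃₂ λ u v → u ℤ.* z ℤ.+ v ℤ.* + p ≡ 1ℤ
prime-bézout {p} pr z p∤z = signed (Cop.coprime-Bézout coprime)
  where
  coprime : Coprime ℤ.∣ z ∣ p
  coprime {d} (d∣z , d∣p) with prime⇒irreducible pr d∣p
  ... | inj₁ d≡1 = d≡1
  ... | inj₂ ≡.refl = ⊥-elim (p∤z (ℤ∣.∣ᵤ⇒∣ d∣z))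

  abs-bézout : Bézout.Identity 1 ℤ.∣ z ∣ p →
               ∃₂ λ u v → u ℤ.* + ℤ.∣ z ∣ ℤ.+ v ℤ.* + p ≡ 1ℤ
  abs-bézout (Bézout.+- x y eq) = + x , ℤ.- + y , (begin
    + x ℤ.* + ℤ.∣ z ∣ ℤ.+ (ℤ.- + y) ℤ.* + p
      ≡⟨ ≡.cong₂ ℤ._+_ (≡.sym (ℤ.pos-* x ℤ.∣ z ∣))
           (≡.trans (≡.sym (ℤ.neg-distribˡ-* (+ y) (+ p))) (≡.cong ℤ.-_ (≡.sym (ℤ.pos-* y p)))) ⟩
    + (x ℕ.* ℤ.∣ z ∣) ℤ.- + (y ℕ.* p)    ≡⟨ ≡.cong (λ t → + t ℤ.- + (y ℕ.* p)) eq ⟨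
    + (1 ℕ.+ y ℕ.* p) ℤ.- + (y ℕ.* p)    ≡⟨ ℤ.+-assoc 1ℤ (+ (y ℕ.* p)) (ℤ.- + (y ℕ.* p)) ⟩
    1ℤ ℤ.+ (+ (y ℕ.* p) ℤ.- + (y ℕ.* p)) ≡⟨ ≡.cong (λ t → 1ℤ ℤ.+ t) (ℤ.+-inverseʳ (+ (y ℕ.* p))) ⟩
    1ℤ ∎)
    where open ≡.≡-Reasoning
  abs-bézout (Bézout.-+ x y eq) = ℤ.- + x , + y , (begin
    (ℤ.- + x) ℤ.* + ℤ.∣ z ∣ ℤ.+ + y ℤ.* + p
      ≡⟨ ≡.cong₂ ℤ._+_ (≡.trans (≡.sym (ℤ.neg-distribˡ-* (+ x) (+ ℤ.∣ z ∣)))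
           (≡.cong ℤ.-_ (≡.sym (ℤ.pos-* x ℤ.∣ z ∣)))) (≡.sym (ℤ.pos-* y p)) ⟩
    ℤ.- + m ℤ.+ + (y ℕ.* p)    ≡⟨ ≡.cong (λ t → ℤ.- + m ℤ.+ + t) eq ⟨
    ℤ.- + m ℤ.+ (1ℤ ℤ.+ + m)   ≡⟨ ≡.cong (λ t → ℤ.- + m ℤ.+ t) (ℤ.+-comm 1ℤ (+ m)) ⟩
    ℤ.- + m ℤ.+ (+ m ℤ.+ 1ℤ)   ≡⟨ ℤ.+-assoc (ℤ.- + m) (+ m) 1ℤ ⟨
    (ℤ.- + m ℤ.+ + m) ℤ.+ 1ℤ   ≡⟨ ≡.cong (ℤ._+ 1ℤ) (ℤ.+-inverseˡ (+ m)) ⟩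
    1ℤ ∎)
    where
    m = x ℕ.* ℤ.∣ z ∣
    open ≡.≡-Reasoning

  -- The natural-number identity concerns `∣ z ∣ = s * z`; the sign `s` is absorbed into the
  -- coefficient of `z`.
  signed : Bézout.Identity 1 ℤ.∣ z ∣ p → ∃₂ λ u v → u ℤ.* z ℤ.+ v ℤ.* + p ≡ 1ℤ
  signed b with abs-bézout b | ℤ∣.m∣∣m∣ {z}
  ... | u , v , eq | divides s ∣z∣≡ = u ℤ.* s , v , ≡.trans
    (≡.cong (ℤ._+ v ℤ.* + p) (≡.trans (ℤ.*-assoc u s z) (≡.cong (u ℤ.*_) (≡.sym ∣z∣≡)))) eq

n<b^n : ∀ b → 1 < b → ∀ n → n < b ℕ.^ n
n<b^n b 1<b zero    = s≤s z≤n
n<b^n b 1<b (suc n) = ℕ.≤-trans (s≤s (n<b^n b 1<b n))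
  (ℕ.≤-trans (ℕ.+-monoˡ-≤ (b ℕ.^ n) (ℕ.≤-trans (s≤s z≤n) (n<b^n b 1<b n)))
  (ℕ.≤-trans (ℕ.≤-reflexive (≡.cong (b ℕ.^ n ℕ.+_) (≡.sym (ℕ.+-identityʳ (b ℕ.^ n)))))
             (ℕ.*-monoˡ-≤ (b ℕ.^ n) 1<b)))

-- The single exponent `k = ∣ z ∣` suffices: `b ^ ∣ z ∣` exceeds `∣ z ∣`, so it can divide `z` only
-- if `z` is zero.
powers-divide⇒≡0 : ∀ b → 1 < b → ∀ z → (∀ k → + (b ℕ.^ k) ℤ∣.∣ z) → z ≡ 0ℤ
powers-divide⇒≡0 b 1<b z div = ℤ.∣i∣≡0⇒i≡0 (lemma ℤ.∣ z ∣ (ℤ∣.∣⇒∣ᵤ (div ℤ.∣ z ∣)))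
  where
  lemma : ∀ n → b ℕ.^ n ℕ∣.∣ n → n ≡ 0
  lemma zero    _ = ≡.refl
  lemma (suc n) d = ⊥-elim (ℕ.<⇒≱ (n<b^n b 1<b (suc n)) (ℕ∣.∣⇒≤ d))

-- Integers inside the rationals, and clearing denominators.

fromℤ-homo : IsRingHomomorphism ℤ.+-*-rawRing ℚ.+-*-rawRing (ℚ._/ 1)
fromℤ-homo = record
  { isSemiringHomomorphism = record
    { isNearSemiringHomomorphism = record
      { +-isMonoidHomomorphism = record
        { isMagmaHomomorphism = record
          { isRelHomomorphism = record { cong = ≡.cong (ℚ._/ 1) }
          ; homo = λ a b → homo₂ {ℚ._+_} {ℚᵘ._+_} ℚ.toℚᵘ-homo-+ ℚᵘ.+-cong a b (a ℤ.+ b)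
                     (*≡* (≡.cong (ℤ._* 1ℤ) (≡.sym (≡.cong₂ ℤ._+_ (ℤ.*-identityʳ a) (ℤ.*-identityʳ b)))))
          }
        ; ε-homo = ≡.refl
        }
      ; *-homo = λ a b → homo₂ {ℚ._*_} {ℚᵘ._*_} ℚ.toℚᵘ-homo-* ℚᵘ.*-cong a b (a ℤ.* b) ℚᵘ.≃-refl
      }
    ; 1#-homo = ≡.refl
    }
  ; -‿homo = λ a → ℚ.toℚᵘ-injective (ℚᵘ.≃-trans (raw (ℤ.- a)) (ℚᵘ.≃-sym
      (ℚᵘ.≃-trans (ℚ.toℚᵘ-homo‿- (a ℚ./ 1)) (ℚᵘ.-‿cong (raw a)))))
  }
  where
  -- `a ℚ./ 1` is normalised and agrees with the literal fraction only up to `≃`, so the identities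
  -- are checked on unnormalised rationals and carried back by injectivity of `toℚᵘ`.
  raw : ∀ a → ℚ.toℚᵘ (a ℚ./ 1) ℚᵘ.≃ mkℚᵘ a 0
  raw a = ℚ.toℚᵘ-fromℚᵘ (mkℚᵘ a 0)

  homo₂ : ∀ {_∙_ : ℚ → ℚ → ℚ} {_∙ᵘ_ : ℚᵘ.ℚᵘ → ℚᵘ.ℚᵘ → ℚᵘ.ℚᵘ} →
          (∀ x y → ℚ.toℚᵘ (x ∙ y) ℚᵘ.≃ ℚ.toℚᵘ x ∙ᵘ ℚ.toℚᵘ y) →
          (∀ {x y u v} → x ℚᵘ.≃ y → u ℚᵘ.≃ v → (x ∙ᵘ u) ℚᵘ.≃ (y ∙ᵘ v)) →
          ∀ a b c → mkℚᵘ c 0 ℚᵘ.≃ (mkℚᵘ a 0 ∙ᵘ mkℚᵘ b 0) →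
          c ℚ./ 1 ≡ (a ℚ./ 1) ∙ (b ℚ./ 1)
  homo₂ toᵘ congᵘ a b c eq = ℚ.toℚᵘ-injective (ℚᵘ.≃-trans (raw c) (ℚᵘ.≃-trans eq
    (ℚᵘ.≃-sym (ℚᵘ.≃-trans (toᵘ (a ℚ./ 1) (b ℚ./ 1)) (congᵘ (raw a) (raw b))))))

module fromℤ = IsRingHomomorphism fromℤ-homo

↧*-≡↥ : ∀ q → ((↧ q) ℚ./ 1) ℚ.* q ≡ (↥ q) ℚ./ 1
↧*-≡↥ q@record{} = ℚ.toℚᵘ-injective (ℚᵘ.≃-trans (ℚ.toℚᵘ-homo-* ((↧ q) ℚ./ 1) q)
  (ℚᵘ.≃-trans (ℚᵘ.*-congʳ {ℚ.toℚᵘ q} (ℚ.toℚᵘ-fromℚᵘ (mkℚᵘ (↧ q) 0)))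
  (ℚᵘ.≃-trans (*≡* (≡.trans (ℤ.*-identityʳ (↧ q ℤ.* ↥ q)) (≡.trans (ℤ.*-comm (↧ q) (↥ q))
       (≡.cong (λ t → ↥ q ℤ.* + t) (≡.sym (ℕ.+-identityʳ (↧ₙ q)))))))
  (ℚᵘ.≃-sym (ℚ.toℚᵘ-fromℚᵘ (mkℚᵘ (↥ q) 0))))))

fromℤ-injective : ∀ {a b} → a ℚ./ 1 ≡ b ℚ./ 1 → a ≡ b
fromℤ-injective {a} {b} eq with ℚ./-injective-≃ (mkℚᵘ a 0) (mkℚᵘ b 0) eq
... | *≡* e = ≡.trans (≡.sym (ℤ.*-identityʳ a)) (≡.trans e (ℤ.*-identityʳ b))

commonDenominator : ∀ {n} (q : Fin n → ℚ) → ∃₂ λ (D : ℤ) (z : Fin n → ℤ) →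
  D ≢ 0ℤ × (∀ i → (D ℚ./ 1) ℚ.* q i ≡ z i ℚ./ 1)
commonDenominator {zero}  q = 1ℤ , (λ ()) , (λ ()) , λ ()
commonDenominator {suc n} q with commonDenominator (λ i → q (Fin.suc i))
... | D , z , D≢0 , eq = D ℤ.* d , z′ , D*d≢0 , eq′
  where
  d = ↧ q Fin.zero
  z′ : Fin (suc n) → ℤ
  z′ Fin.zero    = D ℤ.* ↥ q Fin.zero
  z′ (Fin.suc i) = d ℤ.* z i
  D*d≢0 : D ℤ.* d ≢ 0ℤ
  D*d≢0 e = [ D≢0 , (λ ()) ]′ (ℤ.i*j≡0⇒i≡0∨j≡0 D e)
  scale : ∀ a b (r : ℚ) {c} → (b ℚ./ 1) ℚ.* r ≡ c ℚ./ 1 →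
          ((a ℤ.* b) ℚ./ 1) ℚ.* r ≡ (a ℤ.* c) ℚ./ 1
  scale a b r {c} e = ≡.trans (≡.cong (ℚ._* r) (fromℤ.*-homo a b))
    (≡.trans (ℚ.*-assoc (a ℚ./ 1) (b ℚ./ 1) r)
    (≡.trans (≡.cong ((a ℚ./ 1) ℚ.*_) e) (≡.sym (fromℤ.*-homo a c))))
  eq′ : ∀ i → ((D ℤ.* d) ℚ./ 1) ℚ.* q i ≡ z′ i ℚ./ 1
  eq′ Fin.zero    = scale D d (q Fin.zero) (↧*-≡↥ (q Fin.zero))
  eq′ (Fin.suc i) = ≡.subst (λ t → (t ℚ./ 1) ℚ.* q (Fin.suc i) ≡ (d ℤ.* z i) ℚ./ 1) (ℤ.*-comm d D)
                      (scale d D (q (Fin.suc i)) {z i} (eq i))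

coprime-∣^⇒≡1 : ∀ {m n} d → Coprime m n → m ℕ∣.∣ n ℕ.^ d → m ≡ 1
coprime-∣^⇒≡1 zero    _ m∣1 = ℕ∣.∣1⇒≡1 m∣1
coprime-∣^⇒≡1 (suc d) c m∣  = coprime-∣^⇒≡1 d c (Cop.coprime-divisor c m∣)

abs-^ : ∀ n d → ℤ.∣ n ℤ.^ d ∣ ≡ ℤ.∣ n ∣ ℕ.^ d
abs-^ n zero    = ≡.refl
abs-^ n (suc d) = ≡.trans (ℤ.abs-* n (n ℤ.^ d)) (≡.cong (ℤ.∣ n ∣ ℕ.*_) (abs-^ n d))

↧ₙ-coprime-↥ : ∀ r → Coprime (↧ₙ r) ℤ.∣ ↥ r ∣
-- The coprimality proof stored in a rational is irrelevant, so it has to be recomputed.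
↧ₙ-coprime-↥ (mkℚ n d-1 c) = Cop.sym (Cop.recompute c)

-- Linear algebra: dual systems by elimination.

module DotProduct {c ℓ} (R : CommutativeRing c ℓ) where

  open CommutativeRing R
  open SemiringSum semiring
  open RingProperties ring using (-‿distribˡ-*)
  open SetoidReasoning setoid

  sum-zero : ∀ {n} (f : Vector Carrier n) → (∀ i → f i ≈ 0#) → sum f ≈ 0#
  sum-zero {n} f z = trans (sum-cong-≋ z) (sum-replicate-zero n)

  sum-single : ∀ {n} (f : Vector Carrier n) i → (∀ j → j ≢ i → f j ≈ 0#) → sum f ≈ f i
  sum-single f Fin.zero    z = trans (+-congˡ (sum-zero (f ∘ Fin.suc) (λ j → z (Fin.suc j) λ ()))) (+-identityʳ _)
  sum-single f (Fin.suc i) z = trans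
    (+-cong (z Fin.zero λ ())
            (sum-single (f ∘ Fin.suc) i (λ j j≢i → z (Fin.suc j) (j≢i ∘ Fin.suc-injective))))
    (+-identityˡ _)

  sum-single-toℕ : ∀ {n} (f : ℕ → Carrier) i → i < n → (∀ j → j < n → j ≢ i → f j ≈ 0#) →
                   sum {n} (f ∘ toℕ) ≈ f i
  sum-single-toℕ f i i<n z = trans
    (sum-single (f ∘ toℕ) i′ (λ j j≢ → z (toℕ j) (Fin.toℕ<n j)
      (λ e → j≢ (Fin.toℕ-injective (≡.trans e (≡.sym eq))))))
    (reflexive (≡.cong f eq))
    where
    i′ = Fin.fromℕ< i<n
    eq : toℕ i′ ≡ i
    eq = Fin.toℕ-fromℕ< i<n

  infix 8 _·_
  _·_ : ∀ {m} → Vector Carrier m → Vector Carrier m → Carrier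
  u · v = sum (λ k → u k * v k)

  ·-scale : ∀ {m} a (u v : Vector Carrier m) → (λ k → a * u k) · v ≈ a * (u · v)
  ·-scale a u v = trans (sum-cong-≋ (λ k → *-assoc a (u k) (v k)))
                        (sym (*-distribˡ-sum a (λ k → u k * v k)))

  ·-- : ∀ {m} (t u v : Vector Carrier m) → (λ k → t k - u k) · v ≈ t · v - u · v
  ·-- t u v = begin
    sum (λ k → (t k - u k) * v k)            ≈⟨ sum-cong-≋ (λ k → distribʳ (v k) (t k) (- u k)) ⟩
    sum (λ k → t k * v k + - u k * v k)      ≈⟨ ∑-distrib-+ (λ k → t k * v k) (λ k → - u k * v k) ⟩
    t · v + sum (λ k → - u k * v k)          ≈⟨ +-congˡ (sum-cong-≋ λ k →
                                                   trans (*-congʳ (sym (-1* (u k)))) (*-assoc (- 1#) (u k) (v k))) ⟩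
    t · v + sum (λ k → (- 1#) * (u k * v k)) ≈⟨ +-congˡ (*-distribˡ-sum (- 1#) (λ k → u k * v k)) ⟨
    t · v + (- 1#) * (u · v)                 ≈⟨ +-congˡ (-1* _) ⟩
    t · v - u · v                            ∎
    where
    -1* : ∀ x → (- 1#) * x ≈ - x
    -1* x = trans (sym (-‿distribˡ-* 1# x)) (-‿cong (*-identityˡ x))

  ·-combinationˡ : ∀ {n m} (a : Vector Carrier n) (U : Vector (Vector Carrier m) n) v →
                   (λ k → sum (λ i → a i * U i k)) · v ≈ sum (λ i → a i * (U i · v))
  ·-combinationˡ a U v = begin
    sum (λ k → sum (λ i → a i * U i k) * v k)
      ≈⟨ sum-cong-≋ (λ k → *-distribʳ-sum (v k) (λ i → a i * U i k)) ⟩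
    sum (λ k → sum (λ i → (a i * U i k) * v k))  ≈⟨ ∑-comm (λ k i → (a i * U i k) * v k) ⟩
    sum (λ i → sum (λ k → (a i * U i k) * v k))  ≈⟨ sum-cong-≋ (λ i → ·-scale (a i) (U i) v) ⟩
    sum (λ i → a i * (U i · v))                  ∎

  ·-comm : ∀ {m} (u v : Vector Carrier m) → u · v ≈ v · u
  ·-comm u v = sum-cong-≋ (λ k → *-comm (u k) (v k))

  ·-combinationʳ : ∀ {n m} (a : Vector Carrier n) (U : Vector (Vector Carrier m) n) v →
                   v · (λ k → sum (λ i → a i * U i k)) ≈ sum (λ i → a i * (v · U i))
  ·-combinationʳ a U v = trans (·-comm v (λ k → sum (λ i → a i * U i k))) (trans (·-combinationˡ a U v)
    (sum-cong-≋ (λ i → *-congˡ (·-comm (U i) v))))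

  unit : ∀ {m} → Fin m → Vector Carrier m
  unit k l with l Fin.≟ k
  ... | yes _ = 1#
  ... | no _  = 0#

  unit-· : ∀ {m} (k : Fin m) v → unit k · v ≈ v k
  unit-· k v = trans (sum-single (λ l → unit k l * v l) k off) on
    where
    off : ∀ l → l ≢ k → unit k l * v l ≈ 0#
    off l l≢k with l Fin.≟ k
    ... | yes e = ⊥-elim (l≢k e)
    ... | no _  = zeroˡ (v l)
    on : unit k k * v k ≈ v k
    on with k Fin.≟ k
    ... | yes _ = *-identityˡ (v k)
    ... | no ne = ⊥-elim (ne ≡.refl)

  -- A dual system certifies independence by equations alone, so every ring homomorphism preserves
  -- the certificate. Indexing by `ℕ` lets `n` grow by one without reindexing the vectors.
  record Dual {m} (v : ℕ → Vector Carrier m) (n : ℕ) (N : ℕ → Vector Carrier m) : Set ℓ where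
    field
      on  : ∀ i → i < n → N i · v i ≈ 1#
      off : ∀ i j → i < n → j < n → i ≢ j → N i · v j ≈ 0#

  module Elimination (isField : IsField R) (_≟0 : ∀ x → Dec (x ≈ 0#))
                     {m} (v : ℕ → Vector Carrier m) where

    -- The coefficient of `v n` is normalised to 1; this is what keeps the leading coefficient
    -- nonzero when relations are later summed over their twists.
    Relation : ℕ → Set (c ⊔ ℓ)
    Relation n = ∃ λ (a : Vector Carrier n) → ∀ k → v n k ≈ sum (λ i → a i * v (toℕ i) k)

    module Step (n : ℕ) (N : ℕ → Vector Carrier m) (dual : Dual v n N) where

      open Dual dual

      a : ℕ → Carrier
      a i = N i · v n

      -- The residue of `v n` once its components along the earlier vectors, as measured by the dual
      -- system, are removed. If it vanishes there is a relation; otherwise a nonzero coordinate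
      -- serves as pivot.
      w : Vector Carrier m
      w k = v n k - sum {n} (λ i → a (toℕ i) * v (toℕ i) k)

      relation : (∀ k → w k ≈ 0#) → Relation n
      relation z = (a ∘ toℕ) , λ k → begin
        v n k                                ≈⟨ +-identityʳ _ ⟨
        v n k + 0#                           ≈⟨ +-congˡ (-‿inverseˡ _) ⟨
        v n k + (- s k + s k)                ≈⟨ +-assoc _ _ _ ⟨
        w k + s k                            ≈⟨ +-congʳ (z k) ⟩
        0# + s k                             ≈⟨ +-identityˡ _ ⟩
        s k                                  ∎
        where
        s : ∀ k → Carrier
        s k = sum {n} (λ i → a (toℕ i) * v (toℕ i) k)

      module _ (k : Fin m) (y : Carrier) (wy≈1 : w k * y ≈ 1#) where

        -- The `k`-th coordinate functional, corrected to vanish on the earlier vectors. On `v n`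
        -- the corrected functional takes the value `w k`, so the factor `y` normalises it to 1.
        f : Vector Carrier m
        f l = y * (unit k l - sum {n} (λ i → v (toℕ i) k * N (toℕ i) l))

        f· : ∀ x → f · x ≈ y * (x k - sum {n} (λ i → v (toℕ i) k * (N (toℕ i) · x)))
        f· x = trans (·-scale y _ x) (*-congˡ (trans (·-- (unit k) _ x)
          (+-cong (unit-· k x) (-‿cong (·-combinationˡ (λ (i : Fin n) → v (toℕ i) k) (N ∘ toℕ) x)))))

        f·old : ∀ j → j < n → f · v j ≈ 0#
        f·old j j<n = trans (f· (v j)) (trans (*-congˡ (trans (+-congˡ (-‿cong single)) (-‿inverseʳ _))) (zeroʳ y))
          where
          single : sum {n} (λ i → v (toℕ i) k * (N (toℕ i) · v j)) ≈ v j k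
          single = trans
            (sum-single-toℕ (λ i → v i k * (N i · v j)) j j<n
              (λ i i<n i≢j → trans (*-congˡ (off i j i<n j<n i≢j)) (zeroʳ _)))
            (trans (*-congˡ (on j j<n)) (*-identityʳ _))

        f·new : f · v n ≈ 1#
        f·new = trans (f· (v n)) (trans (*-comm y _) (trans
          (*-congʳ (+-congˡ (-‿cong (sum-cong-≋ {n} (λ i → *-comm (v (toℕ i) k) (a (toℕ i))))))) wy≈1))

        -- Each old functional takes the value `a i` on `v n`. Subtracting `a i` times `f` cancels
        -- this and, since `f` kills the earlier vectors, changes nothing on those.
        N′ : ℕ → Vector Carrier m
        N′ i with i ℕ.≟ n
        ... | yes _ = f
        ... | no _  = λ l → N i l - a i * f l

        <suc : ∀ {i} → i < suc n → i ≢ n → i < n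
        <suc (s≤s i≤n) i≢n = ℕ.≤∧≢⇒< i≤n i≢n

        correct : ∀ i x → (λ l → N i l - a i * f l) · x ≈ N i · x - a i * (f · x)
        correct i x = trans (·-- (N i) _ x) (+-congˡ (-‿cong (·-scale (a i) f x)))

        correct-old : ∀ i j → j < n → (λ l → N i l - a i * f l) · v j ≈ N i · v j
        correct-old i j j<n = begin
          (λ l → N i l - a i * f l) · v j ≈⟨ correct i (v j) ⟩
          N i · v j - a i * (f · v j)     ≈⟨ +-congˡ (-‿cong (trans (*-congˡ (f·old j j<n)) (zeroʳ _))) ⟩
          N i · v j - 0#                  ≈⟨ +-congˡ (trans (sym (+-identityˡ _)) (-‿inverseʳ 0#)) ⟩
          N i · v j + 0#                  ≈⟨ +-identityʳ _ ⟩
          N i · v j                       ∎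

        correct-new : ∀ i → (λ l → N i l - a i * f l) · v n ≈ 0#
        correct-new i = begin
          (λ l → N i l - a i * f l) · v n ≈⟨ correct i (v n) ⟩
          a i - a i * (f · v n)           ≈⟨ +-congˡ (-‿cong (trans (*-congˡ f·new) (*-identityʳ _))) ⟩
          a i - a i                       ≈⟨ -‿inverseʳ _ ⟩
          0#                              ∎

        dual′ : Dual v (suc n) N′
        dual′ = record { on = on′ ; off = off′ }
          where
          on′ : ∀ i → i < suc n → N′ i · v i ≈ 1#
          on′ i i<1+n with i ℕ.≟ n
          ... | yes ≡.refl = f·new
          ... | no i≢n     = trans (correct-old i i (<suc i<1+n i≢n)) (on i (<suc i<1+n i≢n))
          off′ : ∀ i j → i < suc n → j < suc n → i ≢ j → N′ i · v j ≈ 0#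
          off′ i j i<1+n j<1+n i≢j with i ℕ.≟ n | j ℕ.≟ n
          ... | yes ≡.refl | yes ≡.refl = ⊥-elim (i≢j ≡.refl)
          ... | yes ≡.refl | no j≢n     = f·old j (<suc j<1+n j≢n)
          ... | no i≢n     | yes ≡.refl = correct-new i
          ... | no i≢n     | no j≢n     = trans (correct-old i j (<suc j<1+n j≢n))
                                            (off i j (<suc i<1+n i≢n) (<suc j<1+n j≢n) i≢j)

    -- Elimination adds one vector at a time. Decidability of being zero either finds a pivot for
    -- the residue or shows that all its coordinates vanish, and the first vanishing residue gives
    -- the relation.
    dual⊎relation : ∀ n → ∃ (Dual v n) ⊎ ∃ λ j → j < n × Relation j
    dual⊎relation zero    = inj₁ ((λ _ _ → 0#) , record { on = λ _ () ; off = λ _ _ () })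
    dual⊎relation (suc n) with dual⊎relation n
    ... | inj₂ (j , j<n , r) = inj₂ (j , ℕ.m<n⇒m<1+n j<n , r)
    ... | inj₁ (N , dual) with Fin.any? (λ k → ¬? (Step.w n N dual k ≟0))
    ...   | yes (k , wk≉0) = let (y , wy≈1) = IsField.inverse isField _ wk≉0 in
                             inj₁ (_ , Step.dual′ n N dual k y wy≈1)
    ...   | no all≈0 = inj₂ (n , ℕ.n<1+n n , Step.relation n N dual
                         (λ k → decidable-stable (_ ≟0) (λ ne → all≈0 (k , ne))))

-- Additive maps compatible with integer multiples.

module IntegerMultiples {c ℓ} (R : CommutativeRing c ℓ)
  (int : ℤ → CommutativeRing.Carrier R)
  (int-hom : IsRingHomomorphism ℤ.+-*-rawRing (CommutativeRing.rawRing R) int) where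

  open CommutativeRing R
  open SetoidReasoning setoid
  module int = IsRingHomomorphism int-hom

  int-morphism : ℤ.+-*-rawRing ACR.-Raw-AlmostCommutative⟶ ACR.fromCommutativeRing R
  int-morphism = record
    { ⟦_⟧ = int
    ; +-homo = int.+-homo
    ; *-homo = int.*-homo
    ; -‿homo = int.-‿homo
    ; 0-homo = int.0#-homo
    ; 1-homo = int.1#-homo
    }

  int-weaklyDecidable : ∀ a b → Maybe (int a ≈ int b)
  int-weaklyDecidable a b with a ℤ.≟ b
  ... | yes e = just (int.⟦⟧-cong e)
  ... | no _  = nothing

  module Solver = RingSolver ℤ.+-*-rawRing (ACR.fromCommutativeRing R) int-morphism int-weaklyDecidable
  open Solver using (solve; con; _:+_; _:*_; :-_; _:-_; _:=_)

  int-cong : ∀ {a b} x → a ≡ b → int a * x ≈ int b * x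
  int-cong x e = *-congʳ (int.⟦⟧-cong e)

  int0* : ∀ x → int 0ℤ * x ≈ 0#
  int0* x = trans (*-congʳ int.0#-homo) (zeroˡ x)

  int1* : ∀ x → int 1ℤ * x ≈ x
  int1* x = trans (*-congʳ int.1#-homo) (*-identityˡ x)

  int** : ∀ a b x → int (a ℤ.* b) * x ≈ int a * (int b * x)
  int** a b x = trans (*-congʳ (int.*-homo a b)) (*-assoc (int a) (int b) x)

  int+* : ∀ a b x → int (a ℤ.+ b) * x ≈ int a * x + int b * x
  int+* a b x = trans (*-congʳ (int.+-homo a b)) (distribʳ x (int a) (int b))

  record IsLinear (f : Carrier → Carrier) : Set (c ⊔ ℓ) where
    field
      cong  : ∀ {x y} → x ≈ y → f x ≈ f y
      +-hom : ∀ x y → f (x + y) ≈ f x + f y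
      scale : ∀ a x → f (int a * x) ≈ int a * f x

    0-hom : f 0# ≈ 0#
    0-hom = trans (cong (sym (int0* 0#))) (trans (scale 0ℤ 0#) (int0* (f 0#)))

    -1-scale : ∀ x → f (- x) ≈ - f x
    -1-scale x = begin
      f (- x)           ≈⟨ cong (solve 1 (λ x → :- x := con -1ℤ :* x) refl x) ⟩
      f (int -1ℤ * x)   ≈⟨ scale -1ℤ x ⟩
      int -1ℤ * f x     ≈⟨ solve 1 (λ x → con -1ℤ :* x := :- x) refl (f x) ⟩
      - f x             ∎

  open IsLinear

  id-linear : IsLinear (λ x → x)
  id-linear = record { cong = λ e → e ; +-hom = λ _ _ → refl ; scale = λ _ _ → refl }

  ∘-linear : ∀ {f g} → IsLinear f → IsLinear g → IsLinear (f ∘ g)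
  ∘-linear F G = record
    { cong  = λ e → cong F (cong G e)
    ; +-hom = λ x y → trans (cong F (+-hom G x y)) (+-hom F _ _)
    ; scale = λ a x → trans (cong F (scale G a x)) (scale F a _)
    }

  fold-linear : ∀ {f} → IsLinear f → ∀ n → IsLinear (λ x → fold x f n)
  fold-linear F zero    = id-linear
  fold-linear F (suc n) = ∘-linear F (fold-linear F n)

  fold-comm : ∀ {f g} → IsLinear f → (∀ x → f (g x) ≈ g (f x)) → IsLinear g →
              ∀ n x → fold (f x) g n ≈ f (fold x g n)
  fold-comm F fg G zero    x = refl
  fold-comm F fg G (suc n) x = trans (cong G (fold-comm F fg G n x)) (sym (fg _))

  fold-+ : ∀ (f : Carrier → Carrier) m n x → fold x f (m ℕ.+ n) ≡ fold (fold x f n) f m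
  fold-+ f zero    n x = ≡.refl
  fold-+ f (suc m) n x = ≡.cong f (fold-+ f m n x)

  -- Integer polynomials in the difference operator, and sums over powers of θ.

  module Difference (θ : Carrier → Carrier) (θ-linear : IsLinear θ) where

    infixr 9 Δ_
    Δ_ : Carrier → Carrier
    Δ x = θ x - x

    Δ-linear : IsLinear Δ_
    Δ-linear = record
      { cong  = λ e → +-cong (cong θ-linear e) (-‿cong e)
      ; +-hom = λ x y → trans (+-congʳ (+-hom θ-linear x y))
          (solve 4 (λ a b x y → (a :+ b) :- (x :+ y) := (a :- x) :+ (b :- y)) refl (θ x) (θ y) x y)
      ; scale = λ a x → trans (+-congʳ (scale θ-linear a x))
          (solve 3 (λ a b x → a :* b :- a :* x := a :* (b :- x)) refl (int a) (θ x) x)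
      }

    θ≈ : ∀ x → θ x ≈ x + Δ x
    θ≈ x = solve 2 (λ a x → a := x :+ (a :- x)) refl (θ x) x

    Δ^ : ℕ → Carrier → Carrier
    Δ^ k x = fold x Δ_ k

    Δ^-linear : ∀ k → IsLinear (Δ^ k)
    Δ^-linear = fold-linear Δ-linear

    Δ-comm : ∀ {f} → IsLinear f → (∀ x → f (θ x) ≈ θ (f x)) → ∀ x → f (Δ x) ≈ Δ (f x)
    Δ-comm F fθ x = trans (+-hom F _ _) (+-cong (fθ x) (-1-scale F x))

    -- H n c x = Σ_{k<n} c k · Δᵏ x
    H : ℕ → (ℕ → ℤ) → Carrier → Carrier
    H zero    c x = 0#
    H (suc n) c x = int (c 0) * x + Δ (H n (c ∘ suc) x)

    H-cong : ∀ n {c d} → (∀ k → k < n → c k ≡ d k) → ∀ x → H n c x ≈ H n d x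
    H-cong zero    e x = refl
    H-cong (suc n) e x = +-cong (int-cong x (e 0 (s≤s z≤n)))
      (cong Δ-linear (H-cong n (λ k k<n → e (suc k) (s≤s k<n)) x))

    H-+ : ∀ n c d x → H n (λ k → c k ℤ.+ d k) x ≈ H n c x + H n d x
    H-+ zero    c d x = sym (+-identityˡ 0#)
    H-+ (suc n) c d x = trans
      (+-cong (int+* (c 0) (d 0) x)
        (trans (cong Δ-linear (H-+ n (c ∘ suc) (d ∘ suc) x)) (+-hom Δ-linear _ _)))
      (solve 4 (λ a b u v → (a :+ b) :+ (u :+ v) := (a :+ u) :+ (b :+ v)) refl _ _ _ _)

    H-scale : ∀ n a c x → H n (λ k → a ℤ.* c k) x ≈ int a * H n c x
    H-scale zero    a c x = sym (zeroʳ (int a))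
    H-scale (suc n) a c x = trans
      (+-cong (int** a (c 0) x)
        (trans (cong Δ-linear (H-scale n a (c ∘ suc) x)) (scale Δ-linear a _)))
      (sym (distribˡ (int a) _ _))

    H-zero : ∀ n {c} → (∀ k → c k ≡ 0ℤ) → ∀ x → H n c x ≈ 0#
    H-zero zero    e x = refl
    H-zero (suc n) e x = trans
      (+-cong (trans (int-cong x (e 0)) (int0* x))
              (trans (cong Δ-linear (H-zero n (e ∘ suc) x)) (0-hom Δ-linear)))
      (+-identityˡ 0#)

    -- The Horner form exposes the constant term; this exposes the leading one.
    H-last : ∀ n c x → H (suc n) c x ≈ H n c x + int (c n) * Δ^ n x
    H-last zero    c x = trans (+-congˡ (0-hom Δ-linear)) (+-comm _ _)
    H-last (suc n) c x = trans
      (+-congˡ (trans (cong Δ-linear (H-last n (c ∘ suc) x))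
        (trans (+-hom Δ-linear _ _) (+-congˡ (scale Δ-linear (c (suc n)) _)))))
      (sym (+-assoc _ _ _))

    H-comm : ∀ {f} → IsLinear f → (∀ x → f (θ x) ≈ θ (f x)) →
             ∀ n c x → f (H n c x) ≈ H n c (f x)
    H-comm F fθ zero    c x = 0-hom F
    H-comm F fθ (suc n) c x = trans (+-hom F _ _)
      (+-cong (scale F (c 0) x)
        (trans (Δ-comm F fθ _) (cong Δ-linear (H-comm F fθ n (c ∘ suc) x))))

    -- S n x = Σ_{j<n} θʲ x
    S : ℕ → Carrier → Carrier
    S zero    x = 0#
    S (suc n) x = x + θ (S n x)

    S-linear : ∀ n → IsLinear (S n)
    S-linear zero    = record
      { cong = λ _ → refl ; +-hom = λ _ _ → sym (+-identityˡ 0#)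
      ; scale = λ a _ → sym (zeroʳ (int a)) }
    S-linear (suc n) = let T = S-linear n in record
      { cong  = λ e → +-cong e (cong θ-linear (cong T e))
      ; +-hom = λ x y → trans
          (+-congˡ (trans (cong θ-linear (+-hom T x y)) (+-hom θ-linear _ _)))
          (solve 4 (λ a b u v → (a :+ b) :+ (u :+ v) := (a :+ u) :+ (b :+ v)) refl _ _ _ _)
      ; scale = λ a x → trans
          (+-congˡ (trans (cong θ-linear (scale T a x)) (scale θ-linear a _)))
          (sym (distribˡ (int a) _ _))
      }

    S-θ : ∀ n x → S n (θ x) ≈ θ (S n x)
    S-θ zero    x = sym (0-hom θ-linear)
    S-θ (suc n) x = trans (+-congˡ (cong θ-linear (S-θ n x))) (sym (+-hom θ-linear _ _))

    -- Both sides are the sum of the `θʲ x` for `j ≤ n`, split off at the last and at the first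
    -- term. When `θⁿ x = x`, cancelling `x` makes the sum invariant under `θ`.
    S-suc : ∀ n x → S n x + fold x θ n ≈ x + θ (S n x)
    S-suc zero    x = trans (+-comm _ _) (+-congˡ (sym (0-hom θ-linear)))
    S-suc (suc n) x = trans (+-assoc _ _ _)
      (+-congˡ (trans (sym (+-hom θ-linear _ _)) (cong θ-linear (S-suc n x))))

    S-fixed : ∀ n x → fold x θ n ≈ x → θ (S n x) ≈ S n x
    S-fixed n x e = begin
      θ (S n x)              ≈⟨ solve 2 (λ t x → t := (x :+ t) :- x) refl (θ (S n x)) x ⟩
      (x + θ (S n x)) - x    ≈⟨ +-congʳ (S-suc n x) ⟨
      (S n x + fold x θ n) - x ≈⟨ +-congʳ (+-congˡ e) ⟩
      (S n x + x) - x        ≈⟨ solve 2 (λ s x → (s :+ x) :- x := s) refl (S n x) x ⟩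
      S n x                  ∎

    S-Δ : ∀ n x → fold x θ n ≈ x → S n (Δ x) ≈ 0#
    S-Δ n x e = trans (Δ-comm (S-linear n) (S-θ n) x)
      (trans (+-congʳ (S-fixed n x e)) (-‿inverseʳ _))

    S-const : ∀ n {x} → θ x ≈ x → S n x ≈ int (+ n) * x
    S-const zero    {x} e = sym (int0* x)
    S-const (suc n) {x} e = begin
      x + θ (S n x)               ≈⟨ +-congˡ (cong θ-linear (S-const n e)) ⟩
      x + θ (int (+ n) * x)       ≈⟨ +-congˡ (scale θ-linear (+ n) x) ⟩
      x + int (+ n) * θ x         ≈⟨ +-cong (sym (int1* x)) (*-congˡ e) ⟩
      int 1ℤ * x + int (+ n) * x  ≈⟨ int+* 1ℤ (+ n) x ⟨
      int (+ suc n) * x           ∎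

    -- Σ_{j<n} (1+Δ)ʲ = ((1+Δ)ⁿ-1)/Δ
    S-binomial : ∀ m n x → n ≤ m → S n x ≈ H m (λ k → + (n C suc k)) x
    S-binomial m zero    x n≤m = sym (H-zero m (λ k → ≡.cong +_ (k>n⇒nCk≡0 {0} {suc k} (s≤s z≤n))) x)
    S-binomial m (suc n) x n<m = begin
      x + θ (S n x)                  ≈⟨ +-congˡ (cong θ-linear ih) ⟩
      x + θ (H m b x)                ≈⟨ +-congˡ (θ≈ _) ⟩
      x + (H m b x + Δ (H m b x))
        ≈⟨ solve 3 (λ x h d → x :+ (h :+ d) := (con 1ℤ :* x :+ d) :+ h) refl x (H m b x) _ ⟩
      H (suc m) (λ k → + (n C k)) x + H m b x
        ≈⟨ +-congʳ (H-last m _ x) ⟩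
      (H m (λ k → + (n C k)) x + int (+ (n C m)) * Δ^ m x) + H m b x
        ≈⟨ +-congʳ (+-congˡ (trans (int-cong _ (≡.cong +_ (k>n⇒nCk≡0 n<m))) (int0* _))) ⟩
      (H m (λ k → + (n C k)) x + 0#) + H m b x
        ≈⟨ +-congʳ (+-identityʳ _) ⟩
      H m (λ k → + (n C k)) x + H m b x
        ≈⟨ H-+ m _ _ x ⟨
      H m (λ k → + (n C k) ℤ.+ + (n C suc k)) x
        ≈⟨ H-cong m (λ k _ → ≡.cong +_ (nCk+nC[k+1]≡[n+1]C[k+1] n k)) x ⟩
      H m (λ k → + (suc n C suc k)) x ∎
      where
      b : ℕ → ℤ
      b k = + (n C suc k)
      ih = S-binomial m n x (ℕ.<⇒≤ n<m)

    -- The Eisenstein argument on the lattice ℤ[θ]β of trace zero.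

    module PrimePeriod
      (torsion-free : ∀ {a x} → a ≢ 0ℤ → int a * x ≈ 0# → x ≈ 0#)
      (q : ℕ) (prime : Prime (2 ℕ.+ q)) (θ^p≈id : ∀ x → fold x θ (2 ℕ.+ q) ≈ x)
      where

      open SemiringSum semiring using (sum)

      p : ℕ
      p = 2 ℕ.+ q

      P : ℤ
      P = + p

      module Lattice (β : Carrier) (Sβ≈0 : S p β ≈ 0#) where

        -- ℤ[θ] β
        data Span : Carrier → Set (c ⊔ ℓ) where
          gen   : Span β
          add   : ∀ {x y} → Span x → Span y → Span (x + y)
          mult  : ∀ a {x} → Span x → Span (int a * x)
          shift : ∀ {x} → Span x → Span (θ x)
          resp  : ∀ {x y} → x ≈ y → Span x → Span y

        zero-span : Span 0#
        zero-span = resp (int0* β) (mult 0ℤ gen)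

        neg-span : ∀ {x} → Span x → Span (- x)
        neg-span {x} s = resp (solve 1 (λ x → con -1ℤ :* x := :- x) refl x) (mult -1ℤ s)

        Δ-span : ∀ {x} → Span x → Span (Δ x)
        Δ-span s = add (shift s) (neg-span s)

        Δ^-span : ∀ k {x} → Span x → Span (Δ^ k x)
        Δ^-span zero    s = s
        Δ^-span (suc k) s = Δ-span (Δ^-span k s)

        H-span : ∀ n a {x} → Span x → Span (H n a x)
        H-span zero    a s = zero-span
        H-span (suc n) a s = add (mult (a 0) s) (Δ-span (H-span n (a ∘ suc) s))

        S-span : ∀ {x} → Span x → S p x ≈ 0#
        S-span gen        = Sβ≈0
        S-span (add s t)  = trans (+-hom (S-linear p) _ _)
                              (trans (+-cong (S-span s) (S-span t)) (+-identityˡ 0#))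
        S-span (mult a s) = trans (scale (S-linear p) a _)
                              (trans (*-congˡ (S-span s)) (zeroʳ (int a)))
        S-span (shift s)  = trans (S-θ p _) (trans (cong θ-linear (S-span s)) (0-hom θ-linear))
        S-span (resp e s) = trans (cong (S-linear p) (sym e)) (S-span s)

        H-divisible : ∀ n a → (∀ k → k < n → P ℤ∣.∣ a k) → ∀ {x} → Span x →
                      ∃ λ l → Span l × H n a x ≈ int P * l
        H-divisible zero    a d s = 0# , zero-span , sym (zeroʳ (int P))
        H-divisible (suc n) a d {x} s =
          let (divides w e) = d 0 (s≤s z≤n)
              (l , sl , el) = H-divisible n (a ∘ suc) (λ k k<n → d (suc k) (s≤s k<n)) s
          in int w * x + Δ l , add (mult w s) (Δ-span sl) , (begin
            int (a 0) * x + Δ (H n (a ∘ suc) x)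
              ≈⟨ +-cong (int-cong x (≡.trans e (ℤ.*-comm w P))) (cong Δ-linear el) ⟩
            int (P ℤ.* w) * x + Δ (int P * l)
              ≈⟨ +-cong (int** P w x) (scale Δ-linear P l) ⟩
            int P * (int w * x) + int P * Δ l
              ≈⟨ distribˡ (int P) _ _ ⟨
            int P * (int w * x + Δ l) ∎)

        -- On the lattice the sum over powers of `θ` vanishes, and its binomial expansion has
        -- coefficients `p C suc k`. The lowest is `p`, the highest is 1, and those between are
        -- divisible by `p` and contribute `p Δ l`.
        Δ^[p-1] : ∀ {x} → Span x →
                  ∃ λ l → Span l × Δ^ (suc q) x ≈ - (int P * (x + Δ l))
        Δ^[p-1] {x} s =
          let b = λ k → + (p C suc k)
              -- With the constant term removed, index `k` carries `p C (2 + k)`; for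
              -- `k < q = p - 2` the lower index lies strictly between 1 and `p`.
              (l , sl , el) = H-divisible q (b ∘ suc)
                (λ k k<q → ℤ∣.∣ᵤ⇒∣ (prime∣C prime (2 ℕ.+ k) (s≤s z≤n) (s≤s (s≤s k<q)))) s
              first = begin
                H (suc q) b x                       ≡⟨⟩
                int (b 0) * x + Δ (H q (b ∘ suc) x)
                  ≈⟨ +-cong (int-cong x (≡.cong +_ (nC1≡n p))) (cong Δ-linear el) ⟩
                int P * x + Δ (int P * l)           ≈⟨ +-congˡ (scale Δ-linear P l) ⟩
                int P * x + int P * Δ l             ≈⟨ distribˡ (int P) _ _ ⟨
                int P * (x + Δ l)                   ∎
              last = trans (int-cong (Δ^ (suc q) x) (≡.cong +_ (nCn≡1 p))) (int1* _)
              total = begin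
                int P * (x + Δ l) + Δ^ (suc q) x    ≈⟨ +-cong first last ⟨
                H (suc q) b x + int (b (suc q)) * Δ^ (suc q) x ≈⟨ H-last (suc q) b x ⟨
                H p b x                             ≈⟨ S-binomial p p x ℕ.≤-refl ⟨
                S p x                               ≈⟨ S-span s ⟩
                0#                                  ∎
          in l , sl , (begin
            Δ^ (suc q) x                       ≈⟨ solve 2 (λ u v → v := (u :+ v) :- u) refl _ _ ⟩
            (int P * (x + Δ l) + Δ^ (suc q) x) - int P * (x + Δ l)  ≈⟨ +-congʳ total ⟩
            0# - int P * (x + Δ l)             ≈⟨ +-identityˡ _ ⟩
            - (int P * (x + Δ l))              ∎)

        -- By `Δ^[p-1]`, `p x` is `- Δᵖ⁻¹ x - Δ (p l)`. The first term is divisible by `Δʲ⁺¹`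
        -- because `j + 1 ≤ p - 1`, and `p l` is divisible by `Δʲ` by induction.
        pSpan⊆Δ^Span : ∀ j → j ≤ suc q → ∀ {x} → Span x →
                       ∃ λ y → Span y × int P * x ≈ Δ^ j y
        pSpan⊆Δ^Span zero    _ {x} s = int P * x , mult P s , refl
        pSpan⊆Δ^Span (suc j) (s≤s j≤q) {x} s =
          let (l , sl , el) = Δ^[p-1] s
              (y , sy , ey) = pSpan⊆Δ^Span j (ℕ.m≤n⇒m≤1+n j≤q) sl
              i = q ℕ.∸ j
              D = Δ^-linear (suc j)
              split : Δ^ (suc q) x ≡ Δ^ (suc j) (Δ^ i x)
              split = ≡.trans (≡.cong (λ t → Δ^ (suc t) x) (≡.sym (ℕ.m+[n∸m]≡n j≤q)))
                              (fold-+ Δ_ (suc j) i x)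
          in - Δ^ i x - y , add (neg-span (Δ^-span i s)) (neg-span sy) , (begin
            int P * x
              ≈⟨ solve 3 (λ a x d → a :* x := (:- (:- (a :* (x :+ d)))) :- a :* d) refl (int P) x (Δ l) ⟩
            - (- (int P * (x + Δ l))) - int P * Δ l
              ≈⟨ +-cong (-‿cong (sym el)) (-‿cong (trans (sym (scale Δ-linear P l)) (cong Δ-linear ey))) ⟩
            - Δ^ (suc q) x - Δ^ (suc j) y
              ≈⟨ +-congʳ (-‿cong (reflexive split)) ⟩
            - Δ^ (suc j) (Δ^ i x) - Δ^ (suc j) y
              ≈⟨ +-cong (-1-scale D _) (-1-scale D _) ⟨
            Δ^ (suc j) (- Δ^ i x) + Δ^ (suc j) (- y)
              ≈⟨ +-hom D _ _ ⟨
            Δ^ (suc j) (- Δ^ i x - y) ∎)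

        P≢0 : P ≢ 0ℤ
        P≢0 ()

        -- An element killed by `Δ` is fixed by `θ`, so its sum over `p` powers is `p x`. On the
        -- lattice this sum is zero, and `p` can be cancelled.
        Δ-injective : ∀ {x} → Span x → Δ x ≈ 0# → x ≈ 0#
        Δ-injective {x} s e = torsion-free P≢0 (trans (sym (S-const p θx≈x)) (S-span s))
          where
          θx≈x : θ x ≈ x
          θx≈x = trans (θ≈ x) (trans (+-congˡ e) (+-identityʳ x))

        ΔSpan : Carrier → Set (c ⊔ ℓ)
        ΔSpan x = ∃ λ y → Span y × x ≈ Δ y

        module _ (β∈ΔSpan : ΔSpan β) where

          -- `Δ` is additive and commutes with `θ`, so its image on the lattice is again closed
          -- under the lattice operations; containing the generator, it is everything.
          Span⊆ΔSpan : ∀ {x} → Span x → ΔSpan x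
          Span⊆ΔSpan gen        = β∈ΔSpan
          Span⊆ΔSpan (add s t)  =
            let (y , sy , ey) = Span⊆ΔSpan s
                (z , sz , ez) = Span⊆ΔSpan t
            in y + z , add sy sz , trans (+-cong ey ez) (sym (+-hom Δ-linear y z))
          Span⊆ΔSpan (mult a s) =
            let (y , sy , ey) = Span⊆ΔSpan s
            in int a * y , mult a sy , trans (*-congˡ ey) (sym (scale Δ-linear a y))
          Span⊆ΔSpan (shift s)  =
            let (y , sy , ey) = Span⊆ΔSpan s
            in θ y , shift sy , trans (cong θ-linear ey) (Δ-comm θ-linear (λ _ → refl) y)
          Span⊆ΔSpan (resp e s) =
            let (y , sy , ey) = Span⊆ΔSpan s in y , sy , trans (sym e) ey

          Span⊆Δ^Span : ∀ k {x} → Span x → ∃ λ y → Span y × x ≈ Δ^ k y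
          Span⊆Δ^Span zero    {x} s = x , s , refl
          Span⊆Δ^Span (suc k) s =
            let (y , sy , ey) = Span⊆ΔSpan s
                (z , sz , ez) = Span⊆Δ^Span k sy
            in z , sz , trans ey (cong Δ-linear ez)

          -- Every `x` is `Δᵖ⁻¹ y` for some lattice element `y`, and `Δ^[p-1]` turns this into `p`
          -- times a lattice element.
          Span⊆pSpan : ∀ {x} → Span x → ∃ λ y → Span y × x ≈ int P * y
          Span⊆pSpan s =
            let (y , sy , ey) = Span⊆Δ^Span (suc q) s
                (l , sl , el) = Δ^[p-1] sy
            in - (y + Δ l) , neg-span (add sy (Δ-span sl)) , trans ey (trans el
                 (solve 2 (λ a u → :- (a :* u) := a :* (:- u)) refl (int P) _))

          Span⊆p^Span : ∀ k {x} → Span x → ∃ λ y → Span y × x ≈ int (+ (p ℕ.^ k)) * y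
          Span⊆p^Span zero    {x} s = x , s , sym (int1* x)
          Span⊆p^Span (suc k) s =
            let (y , sy , ey) = Span⊆pSpan s
                (z , sz , ez) = Span⊆p^Span k sy
            in z , sz , trans ey (trans (*-congˡ ez) (trans (sym (int** P (+ (p ℕ.^ k)) z))
                 (int-cong z (≡.sym (ℤ.pos-* p (p ℕ.^ k))))))

        module _ (indivisible : ¬ (∀ k → ∃ λ y → Span y × β ≈ int (+ (p ℕ.^ k)) * y)) where

          β∉ΔSpan : ¬ ΔSpan β
          β∉ΔSpan d = indivisible (λ k → Span⊆p^Span d k gen)

          -- `p β` always lies in the image of `Δ`. If `a β` did too with `a` prime to `p`, a Bézout
          -- combination would put `β` itself there.
          multiple∈ΔSpan⇒p∣ : ∀ a → ΔSpan (int a * β) → P ℤ∣.∣ a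
          multiple∈ΔSpan⇒p∣ a (y , sy , ey) with P ℤ∣.∣? a
          ... | yes d = d
          ... | no ¬d =
            let (u , v , e) = prime-bézout prime a ¬d
                (z , sz , ez) = pSpan⊆Δ^Span 1 (s≤s z≤n) gen
            in ⊥-elim (β∉ΔSpan (int u * y + int v * z , add (mult u sy) (mult v sz) , (begin
              β                                       ≈⟨ int1* β ⟨
              int 1ℤ * β                              ≈⟨ int-cong β e ⟨
              int (u ℤ.* a ℤ.+ v ℤ.* P) * β           ≈⟨ int+* _ _ β ⟩
              int (u ℤ.* a) * β + int (v ℤ.* P) * β   ≈⟨ +-cong (int** u a β) (int** v P β) ⟩
              int u * (int a * β) + int v * (int P * β) ≈⟨ +-cong (*-congˡ ey) (*-congˡ ez) ⟩
              int u * Δ y + int v * Δ z               ≈⟨ +-cong (scale Δ-linear u y) (scale Δ-linear v z) ⟨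
              Δ (int u * y) + Δ (int v * z)           ≈⟨ +-hom Δ-linear _ _ ⟨
              Δ (int u * y + int v * z)               ∎)))

          -- Induction on the length. Modulo the image of `Δ` only the constant term is left, so `p`
          -- divides `a 0`. That term can then be moved to the right and one `Δ` cancelled. The
          -- right side is `Δᵐ y` rather than zero precisely so that it can absorb the moved term.
          Δ^-relation⇒p∣ : ∀ m → m ≤ suc q → ∀ a {y} → Span y → H m a β ≈ Δ^ m y →
                           ∀ k → k < m → P ℤ∣.∣ a k
          Δ^-relation⇒p∣ (suc m) m<p a {y} sy e = go
            where
            h = H m (a ∘ suc) β
            sh : Span h
            sh = H-span m (a ∘ suc) gen
            p∣a₀ : P ℤ∣.∣ a 0
            p∣a₀ = multiple∈ΔSpan⇒p∣ (a 0) (Δ^ m y - h , add (Δ^-span m sy) (neg-span sh) , (begin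
              int (a 0) * β              ≈⟨ solve 2 (λ u v → u := (u :+ v) :- v) refl _ (Δ h) ⟩
              (int (a 0) * β + Δ h) - Δ h ≈⟨ +-cong e (sym (-1-scale Δ-linear h)) ⟩
              Δ (Δ^ m y) + Δ (- h)       ≈⟨ +-hom Δ-linear _ _ ⟨
              Δ (Δ^ m y - h)             ∎))
            w = ℤ∣._∣_.quotient p∣a₀
            -- `a 0 β = p (w β)` is divisible by `Δ` to the full length of the relation; this is
            -- where the length must be at most `p - 1`.
            pw = pSpan⊆Δ^Span (suc m) m<p (mult w gen)
            z = proj₁ pw
            sz = proj₁ (proj₂ pw)
            a₀β : int (a 0) * β ≈ Δ (Δ^ m z)
            a₀β = trans (int-cong β (≡.trans (ℤ∣._∣_.equality p∣a₀) (ℤ.*-comm w P)))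
                    (trans (int** P w β) (proj₂ (proj₂ pw)))
            D = Δ^-linear m
            Δd≈0 : Δ (h - Δ^ m (y - z)) ≈ 0#
            Δd≈0 = begin
              Δ (h - Δ^ m (y - z))
                ≈⟨ trans (+-hom Δ-linear _ _) (+-congˡ (-1-scale Δ-linear _)) ⟩
              Δ h - Δ (Δ^ m (y - z))
                ≈⟨ +-congˡ (-‿cong (cong Δ-linear (trans (+-hom D _ _) (+-congˡ (-1-scale D _))))) ⟩
              Δ h - Δ (Δ^ m y - Δ^ m z)
                ≈⟨ +-congˡ (-‿cong (trans (+-hom Δ-linear _ _) (+-congˡ (-1-scale Δ-linear _)))) ⟩
              Δ h - (Δ (Δ^ m y) - Δ (Δ^ m z))     ≈⟨ +-congˡ (-‿cong (+-cong (sym e) (-‿cong (sym a₀β)))) ⟩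
              Δ h - ((int (a 0) * β + Δ h) - int (a 0) * β)
                ≈⟨ solve 2 (λ u v → v :- ((u :+ v) :- u) := con 0ℤ) refl (int (a 0) * β) (Δ h) ⟩
              int 0ℤ                              ≈⟨ int.0#-homo ⟩
              0#                                  ∎
            h≈ : h ≈ Δ^ m (y - z)
            h≈ = begin
              h                                   ≈⟨ solve 2 (λ u v → u := (u :- v) :+ v) refl h _ ⟩
              (h - Δ^ m (y - z)) + Δ^ m (y - z)
                ≈⟨ +-congʳ (Δ-injective (add sh (neg-span (Δ^-span m (add sy (neg-span sz))))) Δd≈0) ⟩
              0# + Δ^ m (y - z)                   ≈⟨ +-identityˡ _ ⟩
              Δ^ m (y - z)                        ∎
            go : ∀ k → k < suc m → P ℤ∣.∣ a k
            go zero    _         = p∣a₀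
            go (suc k) (s≤s k<m) = Δ^-relation⇒p∣ m (ℕ.<⇒≤ m<p) (a ∘ suc)
                                     (add sy (neg-span sz)) h≈ k k<m

          -- An exact relation is the case `y = 0` of the previous lemma. Its coefficients are
          -- divisible by `p`, and by torsion-freeness the quotients satisfy an exact relation
          -- again, so the argument repeats `j` times.
          relation⇒p^∣ : ∀ m → m ≤ suc q → ∀ j a → H m a β ≈ 0# →
                         ∀ k → k < m → + (p ℕ.^ j) ℤ∣.∣ a k
          relation⇒p^∣ m m≤ zero    a e k k<m = divides (a k) (≡.sym (ℤ.*-identityʳ (a k)))
          relation⇒p^∣ m m≤ (suc j) a e k k<m =
            ≡.subst₂ ℤ∣._∣_ (≡.sym (ℤ.pos-* p (p ℕ.^ j))) (≡.sym (w-eq k k<m))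
              (ℤ∣.*-monoʳ-∣ P (relation⇒p^∣ m m≤ j w Hw≈0 k k<m))
            where
            p∣ : ∀ k → k < m → P ℤ∣.∣ a k
            p∣ = Δ^-relation⇒p∣ m m≤ a zero-span (trans e (sym (0-hom (Δ^-linear m))))
            -- A quotient is available only below `m`; `H m` does not see the default `0ℤ` beyond
            -- it.
            w : ℕ → ℤ
            w k with k ℕ.<? m
            ... | yes k<m = ℤ∣._∣_.quotient (p∣ k k<m)
            ... | no _    = 0ℤ
            w-eq : ∀ k → k < m → a k ≡ P ℤ.* w k
            w-eq k k<m with k ℕ.<? m
            ... | yes k<m′ = ≡.trans (ℤ∣._∣_.equality (p∣ k k<m′)) (ℤ.*-comm _ P)
            ... | no k≮m   = ⊥-elim (k≮m k<m)
            Hw≈0 : H m w β ≈ 0#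
            Hw≈0 = torsion-free P≢0 (trans (sym (H-scale m P w β)) (trans (sym (H-cong m w-eq β)) e))

          relation⇒≡0 : ∀ m → m ≤ suc q → ∀ a → H m a β ≈ 0# → ∀ k → k < m → a k ≡ 0ℤ
          relation⇒≡0 m m≤ a e k k<m = powers-divide⇒≡0 p (s≤s (s≤s z≤n)) (a k)
            (λ j → relation⇒p^∣ m m≤ j a e k k<m)

      -- From powers of θ to powers of Δ.

      module _ (α : Carrier) where

        -- The values at `α` of integer polynomials in `Δ` of degree below `n`.
        Low : ℕ → Carrier → Set ℓ
        Low n x = ∃ λ a → x ≈ H n a α

        low-add : ∀ n {x y} → Low n x → Low n y → Low n (x + y)
        low-add n (a , ea) (b , eb) =
          (λ k → a k ℤ.+ b k) , trans (+-cong ea eb) (sym (H-+ n a b α))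

        low-mult : ∀ n z {x} → Low n x → Low n (int z * x)
        low-mult n z (a , ea) = (λ k → z ℤ.* a k) , trans (*-congˡ ea) (sym (H-scale n z a α))

        low-resp : ∀ n {x y} → x ≈ y → Low n x → Low n y
        low-resp n e (a , ea) = a , trans (sym e) ea

        low-Δ : ∀ n {x} → Low n x → Low (suc n) (Δ x)
        low-Δ n (a , ea) = (λ { zero → 0ℤ ; (suc k) → a k }) ,
          trans (cong Δ-linear ea) (sym (trans (+-congʳ (int0* α)) (+-identityˡ _)))

        -- A witness of `Low n` has arbitrary values from index `n` on, so raising the degree must
        -- overwrite them by the intended leading coefficient.
        extend : ℕ → (ℕ → ℤ) → ℤ → ℕ → ℤ
        extend n a z k with k ℕ.<? n
        ... | yes _ = a k
        ... | no _  = z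

        extend-< : ∀ n a z k → k < n → extend n a z k ≡ a k
        extend-< n a z k k<n with k ℕ.<? n
        ... | yes _  = ≡.refl
        ... | no k≮n = ⊥-elim (k≮n k<n)

        extend-≡ : ∀ n a z → extend n a z n ≡ z
        extend-≡ n a z with n ℕ.<? n
        ... | yes n<n = ⊥-elim (ℕ.<-irrefl ≡.refl n<n)
        ... | no _    = ≡.refl

        H-extend : ∀ n a z → H (suc n) (extend n a z) α ≈ H n a α + int z * Δ^ n α
        H-extend n a z = trans (H-last n _ α)
          (+-cong (H-cong n (extend-< n a z) α) (int-cong _ (extend-≡ n a z)))

        low-suc : ∀ n {x} → Low n x → Low (suc n) x
        low-suc n (a , ea) = extend n a 0ℤ ,
          trans ea (sym (trans (H-extend n a 0ℤ) (trans (+-congˡ (int0* _)) (+-identityʳ _))))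

        low-≤ : ∀ {m n x} → m ≤ n → Low m x → Low n x
        low-≤ m≤n l = go (ℕ.≤⇒≤′ m≤n) l
          where
          go : ∀ {m n x} → m ℕ.≤′ n → Low m x → Low n x
          go ℕ.≤′-refl         l = l
          go (ℕ.≤′-step {n} r) l = low-suc n (go r l)

        low-top : ∀ n z {x} → Low n x → Low (suc n) (x + int z * Δ^ n α)
        low-top n z (a , ea) = extend n a z , trans (+-congʳ ea) (sym (H-extend n a z))

        low-zero : ∀ n → Low n 0#
        low-zero n = (λ _ → 0ℤ) , sym (H-zero n (λ _ → ≡.refl) α)

        -- `θⁿ = (1 + Δ)ⁿ` is monic of degree `n` in `Δ`. A relation with leading coefficient `z` in
        -- powers of `θ` therefore keeps it in powers of `Δ`.
        θ^-leading : ∀ n → ∃ λ r → Low n r × fold α θ n ≈ r + Δ^ n α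
        θ^-leading zero    = 0# , low-zero 0 , sym (+-identityˡ α)
        θ^-leading (suc n) =
          let (r , lr , er) = θ^-leading n
          in (r + Δ^ n α) + Δ r
           , low-add (suc n) (low-resp (suc n) (+-congˡ (int1* _)) (low-top n 1ℤ lr)) (low-Δ n lr)
           , (begin
              θ (fold α θ n)                  ≈⟨ θ≈ _ ⟩
              fold α θ n + Δ (fold α θ n)     ≈⟨ +-cong er (trans (cong Δ-linear er) (+-hom Δ-linear _ _)) ⟩
              (r + Δ^ n α) + (Δ r + Δ^ (suc n) α) ≈⟨ +-assoc _ _ _ ⟨
              ((r + Δ^ n α) + Δ r) + Δ^ (suc n) α ∎)

        θ^-low : ∀ n → Low (suc n) (fold α θ n)
        θ^-low n = let (r , lr , er) = θ^-leading n in
          low-resp (suc n) (trans (+-congˡ (int1* _)) (sym er)) (low-top n 1ℤ lr)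

        sum-low : ∀ n {m} (f : Fin m → Carrier) → (∀ i → Low n (f i)) → Low n (sum f)
        sum-low n {zero}  f l = low-zero n
        sum-low n {suc m} f l = low-add n (l Fin.zero) (sum-low n (f ∘ Fin.suc) (l ∘ Fin.suc))

        Δα-trace : S p (Δ α) ≈ 0#
        Δα-trace = S-Δ p α (θ^p≈id α)

        open Lattice (Δ α) Δα-trace using (Span; relation⇒≡0)

        -- Rewritten in powers of `Δ`, the relation has coefficients `e` with `e n = z`. Summing
        -- over `θ` kills all multiples of `Δ`, hence `e 0` times the trace is zero and `e 0`
        -- vanishes. What remains is a relation of length `n ≤ p - 1` on `Δ α`, whose coefficients
        -- are all zero.
        conjugates-independent :
          ¬ (S p α ≈ 0#) →
          ¬ (∀ k → ∃ λ y → Span y × Δ α ≈ int (+ (p ℕ.^ k)) * y) →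
          ∀ n → n < p → ∀ z → z ≢ 0ℤ → (c : Fin n → ℤ) →
          ¬ (int z * fold α θ n ≈ sum (λ i → int (c i) * fold α θ (toℕ i)))
        conjugates-independent Sα≉0 indivisible n n<p z z≢0 c rel = absurd n n<p (extend-≡ n d z) Δ-part
          where
          s = sum (λ i → int (c i) * fold α θ (toℕ i))
          s-low : Low n s
          s-low = sum-low n _ (λ i → low-mult n (c i) (low-≤ (Fin.toℕ<n i) (θ^-low (toℕ i))))
          r = proj₁ (θ^-leading n)
          r-low = proj₁ (proj₂ (θ^-leading n))
          d-low : Low n (int z * r + int -1ℤ * s)
          d-low = low-add n (low-mult n z r-low) (low-mult n -1ℤ s-low)
          d = proj₁ d-low
          e : ℕ → ℤ
          e = extend n d z
          He≈0 : H (suc n) e α ≈ 0#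
          He≈0 = begin
            H (suc n) e α                              ≈⟨ H-extend n d z ⟩
            H n d α + int z * Δ^ n α                   ≈⟨ +-congʳ (sym (proj₂ d-low)) ⟩
            (int z * r + int -1ℤ * s) + int z * Δ^ n α
              ≈⟨ solve 4 (λ z r s d → (z :* r :+ con -1ℤ :* s) :+ z :* d := z :* (r :+ d) :- s)
                   refl (int z) r s (Δ^ n α) ⟩
            int z * (r + Δ^ n α) - s                   ≈⟨ +-congʳ (*-congˡ (proj₂ (proj₂ (θ^-leading n)))) ⟨
            int z * fold α θ n - s                     ≈⟨ +-congʳ rel ⟩
            s - s                                      ≈⟨ -‿inverseʳ s ⟩
            0#                                         ∎
          e₀Sα≈0 : int (e 0) * S p α ≈ 0#
          e₀Sα≈0 = begin
            int (e 0) * S p α                          ≈⟨ +-identityʳ _ ⟨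
            int (e 0) * S p α + 0#
              ≈⟨ +-cong (scale (S-linear p) (e 0) α) (S-Δ p _ (θ^p≈id _)) ⟨
            S p (int (e 0) * α) + S p (Δ (H n (e ∘ suc) α)) ≈⟨ +-hom (S-linear p) _ _ ⟨
            S p (H (suc n) e α)                        ≈⟨ cong (S-linear p) He≈0 ⟩
            S p 0#                                     ≈⟨ 0-hom (S-linear p) ⟩
            0#                                         ∎
          e₀≡0 : e 0 ≡ 0ℤ
          e₀≡0 = decidable-stable (e 0 ℤ.≟ 0ℤ) λ neq → Sα≉0 (torsion-free neq e₀Sα≈0)
          Δ-part : H n (e ∘ suc) (Δ α) ≈ 0#
          Δ-part = begin
            H n (e ∘ suc) (Δ α)
              ≈⟨ H-comm Δ-linear (λ x → sym (Δ-comm θ-linear (λ _ → refl) x)) n (e ∘ suc) α ⟨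
            Δ (H n (e ∘ suc) α)            ≈⟨ +-identityˡ _ ⟨
            0# + Δ (H n (e ∘ suc) α)       ≈⟨ +-congʳ (trans (int-cong α e₀≡0) (int0* α)) ⟨
            H (suc n) e α                  ≈⟨ He≈0 ⟩
            0#                             ∎
          -- For `n = 0` the leading coefficient is the constant term. Otherwise it has index
          -- `n - 1` in the relation on `Δ α`.
          absurd : ∀ n → n < p → e n ≡ z → H n (e ∘ suc) (Δ α) ≈ 0# → ⊥
          absurd zero    _         e≡z _ = z≢0 (≡.trans (≡.sym e≡z) e₀≡0)
          absurd (suc m) (s≤s m<p) e≡z h =
            z≢0 (≡.trans (≡.sym e≡z) (relation⇒≡0 indivisible (suc m) m<p (e ∘ suc) h m (ℕ.n<1+n m)))

  -- The rational root argument.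

  module Integrality (int-injective : ∀ {a} → int a ≈ 0# → a ≡ 0ℤ) where

    open RawSemiringDefs (Semiring.rawSemiring semiring) using (_^_)
    open SemiringSum semiring using (sum; sum-cong-≋; *-distribˡ-sum)

    module _ (D n : ℤ) (α : Carrier) (Dα≈n : int D * α ≈ int n) where

      scaled-power : ∀ d → int (D ℤ.^ d) * α ^ d ≈ int (n ℤ.^ d)
      scaled-power zero    = *-identityʳ _
      scaled-power (suc d) = begin
        int (D ℤ.* D ℤ.^ d) * (α * α ^ d)          ≈⟨ *-congʳ (int.*-homo _ _) ⟩
        (int D * int (D ℤ.^ d)) * (α * α ^ d)
          ≈⟨ solve 4 (λ a b x y → (a :* b) :* (x :* y) := (a :* x) :* (b :* y)) refl _ _ _ _ ⟩
        (int D * α) * (int (D ℤ.^ d) * α ^ d)      ≈⟨ *-cong Dα≈n (scaled-power d) ⟩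
        int n * int (n ℤ.^ d)                      ≈⟨ int.*-homo _ _ ⟨
        int (n ℤ.^ suc d)                          ∎

      -- All terms have degree below `d`, so `Dᵈ` clears their denominators with a factor `D` to
      -- spare.
      scaled-sum : ∀ d (a : Vector ℤ d) → ∃ λ z →
                   int (D ℤ.^ d) * sum (λ i → int (a i) * α ^ toℕ i) ≈ int (D ℤ.* z)
      scaled-sum zero    a = 0ℤ , trans (zeroʳ _) (trans (sym int.0#-homo)
                               (reflexive (≡.cong int (≡.sym (ℤ.*-zeroʳ D)))))
      scaled-sum (suc d) a = let (z , e) = scaled-sum d (a ∘ Fin.suc) in
        D ℤ.^ d ℤ.* a₀ ℤ.+ n ℤ.* z , (begin
          int (D ℤ.* D ℤ.^ d) * (int a₀ * 1# + sum (λ i → int (a (Fin.suc i)) * (α * α ^ toℕ i)))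
            ≈⟨ *-cong (int.*-homo _ _) (+-cong (*-identityʳ _) tail) ⟩
          (int D * int (D ℤ.^ d)) * (int a₀ + α * s)
            ≈⟨ solve 5 (λ D e a x s → (D :* e) :* (a :+ x :* s) := D :* (e :* a) :+ (D :* x) :* (e :* s))
                 refl (int D) (int (D ℤ.^ d)) (int a₀) α s ⟩
          int D * (int (D ℤ.^ d) * int a₀) + (int D * α) * (int (D ℤ.^ d) * s)
            ≈⟨ +-cong (*-congˡ (sym (int.*-homo _ _))) (*-cong Dα≈n (trans e (int.*-homo D z))) ⟩
          int D * int (D ℤ.^ d ℤ.* a₀) + int n * (int D * int z)
            ≈⟨ solve 4 (λ D u n z → D :* u :+ n :* (D :* z) := D :* (u :+ n :* z)) refl _ _ _ _ ⟩
          int D * (int (D ℤ.^ d ℤ.* a₀) + int n * int z)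
            ≈⟨ *-congˡ (+-congˡ (int.*-homo n z)) ⟨
          int D * (int (D ℤ.^ d ℤ.* a₀) + int (n ℤ.* z))
            ≈⟨ *-congˡ (int.+-homo _ _) ⟨
          int D * int (D ℤ.^ d ℤ.* a₀ ℤ.+ n ℤ.* z)
            ≈⟨ int.*-homo D _ ⟨
          int (D ℤ.* (D ℤ.^ d ℤ.* a₀ ℤ.+ n ℤ.* z)) ∎)
        where
        a₀ = a Fin.zero
        s = sum (λ i → int (a (Fin.suc i)) * α ^ toℕ i)
        tail : sum (λ i → int (a (Fin.suc i)) * (α * α ^ toℕ i)) ≈ α * s
        tail = trans
          (sum-cong-≋ (λ i → solve 3 (λ a x y → a :* (x :* y) := x :* (a :* y))
                               refl (int (a (Fin.suc i))) α (α ^ toℕ i)))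
          (sym (*-distribˡ-sum α (λ i → int (a (Fin.suc i)) * α ^ toℕ i)))

      -- Multiplying the monic equation by `Dᵈ` gives `nᵈ + D z = 0` in the integers.
      denominator∣power : ∀ d (a : Vector ℤ d) →
        α ^ d + sum (λ i → int (a i) * α ^ toℕ i) ≈ 0# → ℤ.∣ D ∣ ℕ∣.∣ ℤ.∣ n ∣ ℕ.^ d
      denominator∣power d a root =
        let (z , e) = scaled-sum d a
            eq : n ℤ.^ d ℤ.+ D ℤ.* z ≡ 0ℤ
            eq = int-injective (begin
              int (n ℤ.^ d ℤ.+ D ℤ.* z)       ≈⟨ int.+-homo _ _ ⟩
              int (n ℤ.^ d) + int (D ℤ.* z)   ≈⟨ +-cong (scaled-power d) e ⟨
              int (D ℤ.^ d) * α ^ d + int (D ℤ.^ d) * sum (λ i → int (a i) * α ^ toℕ i)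
                ≈⟨ distribˡ _ _ _ ⟨
              int (D ℤ.^ d) * (α ^ d + sum (λ i → int (a i) * α ^ toℕ i)) ≈⟨ *-congˡ root ⟩
              int (D ℤ.^ d) * 0#              ≈⟨ zeroʳ _ ⟩
              0#                              ∎)
        in ≡.subst (ℤ.∣ D ∣ ℕ∣.∣_) (abs-^ n d) (ℤ∣.∣⇒∣ᵤ
             (ℤ∣.∣m+n∣n⇒∣m {m = n ℤ.^ d} {n = D ℤ.* z} (divides 0ℤ eq) (divides z (ℤ.*-comm D z))))

  -- Traces and the independence of conjugate vectors over the field.

  module Conjugates
    (isField : IsField R) (_≟0 : ∀ x → Dec (x ≈ 0#))
    (ι : ℚ → Carrier) (ι-hom : IsRingHomomorphism ℚ.+-*-rawRing rawRing ι)
    (ι-int : ∀ m → ι (m ℚ./ 1) ≈ int m)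
    (θ : Carrier → Carrier) (θ-hom : IsRingHomomorphism rawRing rawRing θ)
    (θ-ι : ∀ r → θ (ι r) ≈ ι r)
    (fixed⇒rational : ∀ x → θ x ≈ x → ∃ λ r → x ≈ ι r)
    (q : ℕ) (prime : Prime (2 ℕ.+ q)) (θ^p≈id : ∀ x → fold x θ (2 ℕ.+ q) ≈ x)
    where

    open SemiringSum semiring using (sum; sum-cong-≋; *-distribˡ-sum; ∑-distrib-+)
    module θ = IsRingHomomorphism θ-hom
    module ι = IsRingHomomorphism ι-hom

    θ-int : ∀ a → θ (int a) ≈ int a
    θ-int a = trans (θ.⟦⟧-cong (sym (ι-int a))) (trans (θ-ι _) (ι-int a))

    θ-linear : IsLinear θ
    θ-linear = record
      { cong  = θ.⟦⟧-cong
      ; +-hom = θ.+-homo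
      ; scale = λ a x → trans (θ.*-homo _ _) (*-congʳ (θ-int a))
      }

    open Difference θ θ-linear

    int-torsion-free : ∀ {a x} → a ≢ 0ℤ → int a * x ≈ 0# → x ≈ 0#
    int-torsion-free {a} {x} a≢0 ax≈0 = begin
      x                              ≈⟨ *-identityˡ x ⟨
      1# * x                         ≈⟨ *-congʳ inverse ⟨
      (ι (ℚ.1/ r) * int a) * x       ≈⟨ *-assoc _ _ _ ⟩
      ι (ℚ.1/ r) * (int a * x)       ≈⟨ *-congˡ ax≈0 ⟩
      ι (ℚ.1/ r) * 0#                ≈⟨ zeroʳ _ ⟩
      0#                             ∎
      where
      r = a ℚ./ 1
      instance
        r≢0 : ℚ.NonZero r
        r≢0 = ℚ.≢-nonZero (λ e → a≢0 (fromℤ-injective e))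
      inverse : ι (ℚ.1/ r) * int a ≈ 1#
      inverse = trans (*-congˡ (sym (ι-int a))) (trans (sym (ι.*-homo _ _))
        (trans (ι.⟦⟧-cong (ℚ.*-inverseˡ r)) ι.1#-homo))

    int-injective : ∀ {a} → int a ≈ 0# → a ≡ 0ℤ
    int-injective {a} e with a ℤ.≟ 0ℤ
    ... | yes a≡0 = a≡0
    ... | no a≢0  = ⊥-elim (IsField.0≉1 isField
                      (sym (int-torsion-free a≢0 (trans (*-identityʳ _) e))))

    open PrimePeriod int-torsion-free q prime θ^p≈id

    trace-rational : ∀ x → ∃ λ r → S p x ≈ ι r
    trace-rational x = fixed⇒rational (S p x) (S-fixed p x (θ^p≈id x))

    traces-commonDenominator : ∀ {n} (x : Fin n → Carrier) →
      ∃₂ λ D (z : Fin n → ℤ) → D ≢ 0ℤ × (∀ i → int D * S p (x i) ≈ int (z i))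
    traces-commonDenominator x =
      let (D , z , D≢0 , e) = commonDenominator (λ i → proj₁ (trace-rational (x i)))
      in D , z , D≢0 , λ i → begin
        int D * S p (x i)
          ≈⟨ *-cong (sym (ι-int D)) (proj₂ (trace-rational (x i))) ⟩
        ι (D ℚ./ 1) * ι (proj₁ (trace-rational (x i)))   ≈⟨ ι.*-homo _ _ ⟨
        ι ((D ℚ./ 1) ℚ.* proj₁ (trace-rational (x i)))   ≈⟨ ι.⟦⟧-cong (e i) ⟩
        ι (z i ℚ./ 1)                                    ≈⟨ ι-int (z i) ⟩
        int (z i)                                        ∎

    fold-θ-cong : ∀ k {x y} → x ≈ y → fold x θ k ≈ fold y θ k
    fold-θ-cong k = cong (fold-linear θ-linear k)

    fold-*p : ∀ m x → fold x θ (m ℕ.* p) ≈ x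
    fold-*p zero    x = refl
    fold-*p (suc m) x = trans (reflexive (fold-+ θ p (m ℕ.* p) x)) (trans (θ^p≈id _) (fold-*p m x))

    fold-% : ∀ k x → fold x θ k ≈ fold x θ (k ℕ.% p)
    fold-% k x = begin
      fold x θ k                                    ≡⟨ ≡.cong (fold x θ) (m≡m%n+[m/n]*n k p) ⟩
      fold x θ (k ℕ.% p ℕ.+ k ℕ./ p ℕ.* p)          ≡⟨ fold-+ θ (k ℕ.% p) _ x ⟩
      fold (fold x θ (k ℕ./ p ℕ.* p)) θ (k ℕ.% p)   ≈⟨ fold-θ-cong (k ℕ.% p) (fold-*p (k ℕ./ p) x) ⟩
      fold x θ (k ℕ.% p)                            ∎

    module _ (β γ : Carrier) (βγ≈1 : β * γ ≈ 1#) (Sβ≈0 : S p β ≈ 0#) where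

      open Lattice β Sβ≈0

      private
        denominators = traces-commonDenominator (λ (j : Fin p) → γ * fold β θ (toℕ j))
        D = proj₁ denominators
        D≢0 = proj₁ (proj₂ (proj₂ denominators))
        integral = proj₂ (proj₂ (proj₂ denominators))

      -- The functional `y ↦ Tr (γ y)` has bounded denominators on the lattice. All powers of `θ`
      -- are carried along so that `shift` merely raises `j`; at the generator, `j` is reduced
      -- modulo `p` to one of the finitely many conjugates from which `D` was chosen.
      pairing-integral : ∀ {y} → Span y → ∀ j → ∃ λ z → int D * S p (γ * fold y θ j) ≈ int z
      pairing-integral gen j = _ , trans
        (*-congˡ (cong (S-linear p) (*-congˡ (trans (fold-% j β)
          (reflexive (≡.cong (fold β θ) (≡.sym (Fin.toℕ-fromℕ< j%p<p))))))))
        (integral (Fin.fromℕ< j%p<p))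
        where j%p<p = m%n<n j p
      pairing-integral (add {x} {y} s t) j =
        let (a , ea) = pairing-integral s j
            (b , eb) = pairing-integral t j
        in a ℤ.+ b , (begin
          int D * S p (γ * fold (x + y) θ j)
            ≈⟨ *-congˡ (cong (S-linear p) (trans (*-congˡ (+-hom (fold-linear θ-linear j) x y)) (distribˡ γ _ _))) ⟩
          int D * S p (γ * fold x θ j + γ * fold y θ j)
            ≈⟨ trans (*-congˡ (+-hom (S-linear p) _ _)) (distribˡ (int D) _ _) ⟩
          int D * S p (γ * fold x θ j) + int D * S p (γ * fold y θ j)
            ≈⟨ trans (+-cong ea eb) (sym (int.+-homo a b)) ⟩
          int (a ℤ.+ b) ∎)
      pairing-integral (mult a {x} s) j =
        let (b , eb) = pairing-integral s j
        in a ℤ.* b , (begin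
          int D * S p (γ * fold (int a * x) θ j)
            ≈⟨ *-congˡ (cong (S-linear p) (trans (*-congˡ (scale (fold-linear θ-linear j) a x))
                 (solve 3 (λ g a y → g :* (a :* y) := a :* (g :* y)) refl γ (int a) (fold x θ j)))) ⟩
          int D * S p (int a * (γ * fold x θ j))
            ≈⟨ trans (*-congˡ (scale (S-linear p) a _))
                 (solve 3 (λ d a y → d :* (a :* y) := a :* (d :* y)) refl (int D) (int a) _) ⟩
          int a * (int D * S p (γ * fold x θ j))
            ≈⟨ trans (*-congˡ eb) (sym (int.*-homo a b)) ⟩
          int (a ℤ.* b) ∎)
      pairing-integral (shift {x} s) j =
        let (a , ea) = pairing-integral s (suc j)
        in a , trans (*-congˡ (cong (S-linear p) (*-congˡ
                 (fold-comm θ-linear (λ _ → refl) θ-linear j x)))) ea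
      pairing-integral (resp e s) j =
        let (a , ea) = pairing-integral s j
        in a , trans (*-congˡ (cong (S-linear p) (*-congˡ (fold-θ-cong j (sym e))))) ea

      -- If `β = pᵏ y`, pairing with `γ = β⁻¹` shows that `pᵏ` divides `D Tr 1 = D p`. For all `k`
      -- at once this forces `D = 0`.
      indivisible : ¬ (∀ k → ∃ λ y → Span y × β ≈ int (+ (p ℕ.^ k)) * y)
      indivisible divisible = D≢0
        (ℤ.*-cancelʳ-≡ D 0ℤ P (powers-divide⇒≡0 p (s≤s (s≤s z≤n)) (D ℤ.* P) divides-DP))
        where
        divides-DP : ∀ k → + (p ℕ.^ k) ℤ∣.∣ D ℤ.* P
        divides-DP k =
          let (y , sy , ey) = divisible k
              (z , ez) = pairing-integral sy 0
              p^k = + (p ℕ.^ k)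
          in divides z (ℤ.i-j≡0⇒i≡j _ _ (int-injective (begin
            int (D ℤ.* P ℤ.- z ℤ.* p^k)           ≈⟨ trans (int.+-homo _ _) (+-congˡ (int.-‿homo _)) ⟩
            int (D ℤ.* P) - int (z ℤ.* p^k)       ≈⟨ +-cong (int.*-homo D P) (-‿cong (int.*-homo z p^k)) ⟩
            int D * int P - int z * int p^k
              ≈⟨ +-cong (*-congˡ (sym (*-identityʳ _))) (-‿cong (*-congʳ (sym ez))) ⟩
            int D * (int P * 1#) - (int D * S p (γ * y)) * int p^k
              ≈⟨ +-congʳ (*-congˡ (sym (S-const p θ.1#-homo))) ⟩
            int D * S p 1# - (int D * S p (γ * y)) * int p^k
              ≈⟨ +-congʳ (*-congˡ (cong (S-linear p) (sym (trans (*-comm γ β) βγ≈1)))) ⟩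
            int D * S p (γ * β) - (int D * S p (γ * y)) * int p^k
              ≈⟨ +-congʳ (*-congˡ (cong (S-linear p) (trans (*-congˡ ey)
                   (solve 3 (λ g a y → g :* (a :* y) := a :* (g :* y)) refl γ (int p^k) y)))) ⟩
            int D * S p (int p^k * (γ * y)) - (int D * S p (γ * y)) * int p^k
              ≈⟨ +-congʳ (*-congˡ (scale (S-linear p) p^k _)) ⟩
            int D * (int p^k * S p (γ * y)) - (int D * S p (γ * y)) * int p^k
              ≈⟨ solve 3 (λ d a s → d :* (a :* s) :- (d :* s) :* a := con 0ℤ) refl (int D) (int p^k) (S p (γ * y)) ⟩
            int 0ℤ                                ≈⟨ int.0#-homo ⟩
            0#                                    ∎)))

    sum-hom : ∀ {f} → IsLinear f → ∀ {n} (x : Fin n → Carrier) → f (sum x) ≈ sum (f ∘ x)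
    sum-hom F {zero}  x = 0-hom F
    sum-hom F {suc n} x = trans (+-hom F _ _) (+-congˡ (sum-hom F (x ∘ Fin.suc)))

    sum≈S : ∀ n x → sum {n} (λ i → fold x θ (toℕ i)) ≈ S n x
    sum≈S zero    x = refl
    sum≈S (suc n) x = +-congˡ (trans (sym (sum-hom θ-linear {n} (λ i → fold x θ (toℕ i))))
                        (cong θ-linear (sum≈S n x)))

    module _ (α : Carrier) (α-moved : ¬ (θ α ≈ α)) (Sα≉0 : ¬ (S p α ≈ 0#)) where

      module _ (n : ℕ) where

        -- The twisted relation t θⁿα = Σ θ⁻ᵏ(aᵢ) θⁱα, for every k.
        Rel : ℤ → (Fin n → Carrier) → Set ℓ
        Rel t a = ∀ k → int t * fold (fold α θ n) θ k ≈ sum (λ i → a i * fold (fold α θ (toℕ i)) θ k)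

        rel-+ : ∀ {t u a b} → Rel t a → Rel u b → Rel (t ℤ.+ u) (λ i → a i + b i)
        rel-+ {t} {u} {a} {b} A B k = trans (int+* t u _) (trans (+-cong (A k) (B k))
          (trans (sym (∑-distrib-+ {n} (λ i → a i * fold (fold α θ (toℕ i)) θ k)
                                    (λ i → b i * fold (fold α θ (toℕ i)) θ k)))
                 (sum-cong-≋ {n} (λ i → sym (distribʳ _ (a i) (b i))))))

        -- `θ` is applied to the relation at `k + (p - 1)`, which by periodicity stands for `k - 1`.
        -- The conjugates return to position `k` while the coefficients are moved by `θ`.
        rel-θ : ∀ {t a} → Rel t a → Rel t (θ ∘ a)
        rel-θ {t} {a} A k = begin
          int t * fold (fold α θ n) θ k                ≈⟨ *-congˡ (period _) ⟩
          int t * θ (fold (fold α θ n) θ (k ℕ.+ suc q)) ≈⟨ scale θ-linear t _ ⟨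
          θ (int t * fold (fold α θ n) θ (k ℕ.+ suc q)) ≈⟨ cong θ-linear (A (k ℕ.+ suc q)) ⟩
          θ (sum (λ i → a i * fold (fold α θ (toℕ i)) θ (k ℕ.+ suc q)))
            ≈⟨ sum-hom θ-linear {n} (λ i → a i * fold (fold α θ (toℕ i)) θ (k ℕ.+ suc q)) ⟩
          sum (λ i → θ (a i * fold (fold α θ (toℕ i)) θ (k ℕ.+ suc q)))
            ≈⟨ sum-cong-≋ {n} (λ i → trans (θ.*-homo _ _) (*-congˡ (sym (period (fold α θ (toℕ i)))))) ⟩
          sum (λ i → θ (a i) * fold (fold α θ (toℕ i)) θ k) ∎
          where
          period : ∀ x → fold x θ k ≈ θ (fold x θ (k ℕ.+ suc q))
          period x = begin
            fold x θ k                  ≈⟨ fold-θ-cong k (θ^p≈id x) ⟨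
            fold (fold x θ p) θ k       ≡⟨ fold-+ θ k p x ⟨
            fold x θ (k ℕ.+ p)          ≡⟨ ≡.cong (fold x θ) (ℕ.+-suc k (suc q)) ⟩
            θ (fold x θ (k ℕ.+ suc q))  ∎

        -- Adds the first `m` twists. For `m = p` the coefficients become traces, hence rational.
        rel-S : ∀ {a} → Rel 1ℤ a → ∀ m → Rel (+ m) (S m ∘ a)
        rel-S {a} A zero    k = trans (int0* _) (sym (trans
          (sum-cong-≋ {n} (λ i → trans (zeroˡ _) (sym (zeroˡ 0#))))
          (trans (sym (*-distribˡ-sum {n} 0# (λ _ → 0#))) (zeroˡ _))))
        rel-S A (suc m) = rel-+ {1ℤ} {+ m} A (rel-θ {+ m} (rel-S A m))

      -- The `K`-valued form of `σ(θʲ α)`, before the real embedding is applied.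
      conjugate : ℕ → Vector Carrier p
      conjugate j k = fold (fold α θ j) θ (toℕ k)

      open DotProduct R using (Dual; module Elimination)
      open Elimination isField _≟0 conjugate using (Relation; dual⊎relation)

      -- A relation between vectors gives the `p` coordinates; periodicity supplies every other
      -- power `k`.
      relation⇒rel : ∀ n (r : Relation n) → Rel n 1ℤ (proj₁ r)
      relation⇒rel n (a , e) k = begin
        int 1ℤ * fold (fold α θ n) θ k             ≈⟨ int1* _ ⟩
        fold (fold α θ n) θ k                      ≈⟨ reduce (fold α θ n) ⟩
        conjugate n j                              ≈⟨ e j ⟩
        sum (λ i → a i * conjugate (toℕ i) j)
          ≈⟨ sum-cong-≋ {n} (λ i → *-congˡ (sym (reduce (fold α θ (toℕ i))))) ⟩
        sum (λ i → a i * fold (fold α θ (toℕ i)) θ k) ∎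
        where
        k%p<p = m%n<n k p
        j = Fin.fromℕ< k%p<p
        reduce : ∀ x → fold x θ k ≈ fold x θ (toℕ j)
        reduce x = trans (fold-% k x) (reflexive (≡.cong (fold x θ) (≡.sym (Fin.toℕ-fromℕ< k%p<p))))

      Δα≉0 : ¬ (Δ α ≈ 0#)
      Δα≉0 e = α-moved (trans (θ≈ α) (trans (+-congˡ e) (+-identityʳ α)))

      -- Summing the twists and clearing the denominators `D` of the traces gives an integer
      -- relation with leading coefficient `D p`, which `conjugates-independent` excludes.
      no-relation : ∀ n → n < p → ¬ Relation n
      no-relation n n<p r =
        let a = proj₁ r
            (D , z , D≢0 , e) = traces-commonDenominator a
            (γ , βγ≈1) = IsField.inverse isField (Δ α) Δα≉0
            rel = begin
              int (D ℤ.* P) * fold α θ n                     ≈⟨ int** D P _ ⟩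
              -- All `p` twists are summed and the result is read at `k = 0`; the coefficient 1 of
              -- the leading conjugate has become `p`.
              int D * (int P * fold α θ n)                   ≈⟨ *-congˡ (rel-S n (relation⇒rel n r) p 0) ⟩
              int D * sum (λ i → S p (a i) * fold α θ (toℕ i))
                ≈⟨ *-distribˡ-sum {n} (int D) (λ i → S p (a i) * fold α θ (toℕ i)) ⟩
              sum (λ i → int D * (S p (a i) * fold α θ (toℕ i)))
                ≈⟨ sum-cong-≋ {n} (λ i → trans (sym (*-assoc _ _ _)) (*-congʳ (e i))) ⟩
              sum (λ i → int (z i) * fold α θ (toℕ i))       ∎
        in conjugates-independent α Sα≉0 (indivisible (Δ α) γ βγ≈1 (Δα-trace α)) n n<p (D ℤ.* P)
             (λ DP≡0 → D≢0 (ℤ.*-cancelʳ-≡ D 0ℤ P DP≡0)) z rel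

      dual : ∃ (Dual conjugate p)
      dual with dual⊎relation p
      ... | inj₁ d             = d
      ... | inj₂ (n , n<p , r) = ⊥-elim (no-relation n n<p r)

-- Transfer of independence along a ring homomorphism.

module Vectors {r ℓr s ℓs} (R : CommutativeRing r ℓr) (S : CommutativeRing s ℓs)
  (φ : CommutativeRing.Carrier R → CommutativeRing.Carrier S)
  (φ-hom : IsRingHomomorphism (CommutativeRing.rawRing R) (CommutativeRing.rawRing S) φ)
  (m : ℕ) where

  private
    module R = CommutativeRing R
    module S = CommutativeRing S
    module R· = DotProduct R
    module S· = DotProduct S
    module ΣR = SemiringSum R.semiring
    module ΣS = SemiringSum S.semiring
    module φ = IsRingHomomorphism φ-hom

  S^m : LeftModule S.ring s ℓs
  S^m = S.ring ^ᵐ m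

  open LeftModule S^m using (_≈ᴹ_)
  open SetoidReasoning S.setoid

  φ-sum : ∀ {n} (x : Vector R.Carrier n) → φ (ΣR.sum x) S.≈ ΣS.sum (φ ∘ x)
  φ-sum {zero}  x = φ.0#-homo
  φ-sum {suc n} x = S.trans (φ.+-homo _ _) (S.+-congˡ (φ-sum (x ∘ Fin.suc)))

  φ-· : ∀ {n} (u v : Vector R.Carrier n) → φ (u R·.· v) S.≈ (φ ∘ u) S·.· (φ ∘ v)
  φ-· u v = S.trans (φ-sum (λ k → u k R.* v k)) (ΣS.sum-cong-≋ (λ k → φ.*-homo (u k) (v k)))

  linearCombination-at : ∀ {n} (a : Vector S.Carrier n) (v : Vector (Vector S.Carrier m) n) k →
    linearCombination S^m a v k ≡ ΣS.sum (λ i → a i S.* v i k)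
  linearCombination-at {zero}  a v k = ≡.refl
  linearCombination-at {suc n} a v k =
    ≡.cong (a Fin.zero S.* v Fin.zero k S.+_) (linearCombination-at (a ∘ Fin.suc) (v ∘ Fin.suc) k)

  -- Pairing the combination with the image under `φ` of the functional dual to the `i`-th vector
  -- isolates `a i`, for arbitrary coefficients in the larger ring.
  dual⇒independent : ∀ (v : ℕ → Vector R.Carrier m) {p N} → R·.Dual v p N →
    ∀ {n} (w : Vector (Vector S.Carrier m) n) (j : Fin n → Fin p) →
    (∀ i → w i ≈ᴹ φ ∘ v (toℕ (j i))) → Injective _≡_ _≈ᴹ_ w → IndependentFamily S^m w
  dual⇒independent v {p} {N} dual {n} w j w≈ w-inj a lc≈0 i = begin
    a i                                  ≈⟨ S.*-identityʳ _ ⟨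
    a i S.* S.1#
      ≈⟨ S.*-congˡ (S.trans (M·w i) (S.trans (φ.⟦⟧-cong (on _ (Fin.toℕ<n (j i)))) φ.1#-homo)) ⟨
    a i S.* (M S·.· w i)                 ≈⟨ S·.sum-single (λ l → a l S.* (M S·.· w l)) i vanish ⟨
    ΣS.sum (λ l → a l S.* (M S·.· w l))  ≈⟨ S·.·-combinationʳ a w M ⟨
    M S·.· (λ k → ΣS.sum (λ l → a l S.* w l k))
      ≈⟨ S·.sum-zero _ (λ k → S.trans (S.*-congˡ (S.trans
           (S.reflexive (≡.sym (linearCombination-at a w k))) (lc≈0 k))) (S.zeroʳ _)) ⟩
    S.0#                                 ∎
    where
    open R·.Dual dual
    M : Vector S.Carrier m
    M = φ ∘ N (toℕ (j i))
    M·w : ∀ l → M S·.· w l S.≈ φ (N (toℕ (j i)) R·.· v (toℕ (j l)))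
    M·w l = S.trans (ΣS.sum-cong-≋ (λ k → S.*-congˡ (w≈ l k))) (S.sym (φ-· (N (toℕ (j i))) (v (toℕ (j l)))))
    -- Two vectors with the same index `j` would be equal, so distinctness of the `w` makes `j`
    -- injective.
    separated : ∀ l → l ≢ i → toℕ (j i) ≢ toℕ (j l)
    separated l l≢i e = l≢i (w-inj (λ k → S.trans (w≈ l k)
      (S.trans (S.reflexive (≡.cong (λ t → φ (v t k)) (≡.sym e))) (S.sym (w≈ i k)))))
    vanish : ∀ l → l ≢ i → a l S.* (M S·.· w l) S.≈ S.0#
    vanish l l≢i = S.trans (S.*-congˡ (S.trans (M·w l) (S.trans
      (φ.⟦⟧-cong (off _ _ (Fin.toℕ<n (j i)) (Fin.toℕ<n (j l)) (separated l l≢i))) φ.0#-homo))) (S.zeroʳ _)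

-- The cyclic field: order of the generator, distinct conjugates, both implications.

module CyclicField {c ℓ} (q : ℕ) (prime : Prime (2 ℕ.+ q)) (K : NumberField (2 ℕ.+ q) c ℓ)
  (cyclic : IsCyclicGalois K) (θ : Gal K) (generates : Generates K θ) where

  open NumberField K
  open IsCyclicGalois cyclic
  open Gal
  open SetoidReasoning setoid
  open SemiringSum semiring using (sum; sum-cong-≋; *-distribˡ-sum)
  private
    module G = Setoid (Gal-setoid K)
    module order = Inverse order
    module ι = IsRingHomomorphism ι-hom
    module θ = IsRingIsomorphism (isIso θ)

  p : ℕ
  p = 2 ℕ.+ q

  int-hom : IsRingHomomorphism ℤ.+-*-rawRing rawRing (fromℤ K)
  int-hom = Composition.isRingHomomorphism trans fromℤ-homo ι-hom

  open IntegerMultiples commutativeRing (fromℤ K) int-hom using (fold-+)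

  -- The test is made on the rational coordinates in the given basis.
  _≟0 : ∀ x → Dec (x ≈ 0#)
  x ≟0 = let (a , x≈) = basis-spanning x in map′
    (λ a≡0 → trans x≈ (DotProduct.sum-zero commutativeRing (λ i → ι (a i) * basis i)
      (λ i → trans (*-congʳ (trans (ι.⟦⟧-cong (a≡0 i)) ι.0#-homo)) (zeroˡ _))))
    (λ x≈0 → basis-independent a (trans (sym x≈) x≈0))
    (Fin.all? (λ i → a i ℚ.≟ ℚ.0ℚ))

  θ^ : ℕ → Gal K
  θ^ k = record
    { ⟦_⟧ = λ x → iter K θ k x
    ; isIso = iso k
    ; fixesℚ = fixes k
    }
    where
    iso : ∀ k → IsRingIsomorphism rawRing rawRing (λ x → iter K θ k x)
    iso zero    = Identity.isRingIsomorphism rawRing refl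
    iso (suc k) = Composition.isRingIsomorphism trans (iso k) (isIso θ)
    fixes : ∀ k r → iter K θ k (ι r) ≈ ι r
    fixes zero    r = refl
    fixes (suc k) r = trans (θ.⟦⟧-cong (fixes k r)) (fixesℚ θ r)

  module θ^ k = IsRingIsomorphism (isIso (θ^ k))

  fold-cancel : ∀ i d x → fold x ⟦ θ ⟧ (i ℕ.+ d) ≈ fold x ⟦ θ ⟧ i → fold x ⟦ θ ⟧ d ≈ x
  fold-cancel i d x e = θ^.injective i (trans (reflexive (≡.sym (fold-+ ⟦ θ ⟧ i d x))) e)

  fold-period : ∀ d x → fold x ⟦ θ ⟧ d ≈ x → ∀ m → fold x ⟦ θ ⟧ (m ℕ.* d) ≈ x
  fold-period d x e zero    = refl
  fold-period d x e (suc m) = trans (reflexive (fold-+ ⟦ θ ⟧ d (m ℕ.* d) x))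
    (trans (θ^.⟦⟧-cong d (fold-period d x e m)) e)

  -- If `θᵈ` is the identity, every automorphism is a power of `θ` with exponent reduced modulo `d`,
  -- so the `p` elements of the group inject into `Fin d`.
  period≥p : ∀ d .{{_ : ℕ.NonZero d}} → (∀ x → fold x ⟦ θ ⟧ d ≈ x) → p ≤ d
  period≥p d e = Fin.injective⇒≤ {f = f} f-injective
    where
    exponent : Fin p → ℕ
    exponent a = proj₁ (generates (order.to a))
    reduce : ∀ a → order.to a G.≈ θ^ (exponent a ℕ.% d)
    reduce a x = let k = exponent a in begin
      ⟦ order.to a ⟧ x                                 ≈⟨ proj₂ (generates (order.to a)) x ⟩
      fold x ⟦ θ ⟧ k                                   ≡⟨ ≡.cong (fold x ⟦ θ ⟧) (m≡m%n+[m/n]*n k d) ⟩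
      fold x ⟦ θ ⟧ (k ℕ.% d ℕ.+ k ℕ./ d ℕ.* d)         ≡⟨ fold-+ ⟦ θ ⟧ (k ℕ.% d) _ x ⟩
      fold (fold x ⟦ θ ⟧ (k ℕ./ d ℕ.* d)) ⟦ θ ⟧ (k ℕ.% d)
        ≈⟨ θ^.⟦⟧-cong (k ℕ.% d) (fold-period d x (e x) (k ℕ./ d)) ⟩
      fold x ⟦ θ ⟧ (k ℕ.% d)                           ∎
    f : Fin p → Fin d
    f a = Fin.fromℕ< (m%n<n (exponent a) d)
    f-injective : Injective _≡_ _≡_ f
    f-injective {a} {b} fa≡fb = ≡.trans (≡.sym (order.strictlyInverseʳ a))
      (order.inverseʳ (G.trans {order.to a} {θ^ (exponent a ℕ.% d)} {order.to b} (reduce a)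
        (G.trans {θ^ (exponent a ℕ.% d)} {θ^ (exponent b ℕ.% d)} {order.to b}
          (λ x → reflexive (≡.cong (fold x ⟦ θ ⟧) same)) (λ x → sym (reduce b x)))))
      where
      same : exponent a ℕ.% d ≡ exponent b ℕ.% d
      same = ≡.trans (≡.sym (Fin.toℕ-fromℕ< (m%n<n (exponent a) d)))
               (≡.trans (≡.cong toℕ fa≡fb) (Fin.toℕ-fromℕ< (m%n<n (exponent b) d)))

  -- Among the `p + 1` powers from `θ⁰` to `θᵖ` two coincide. Their exponents differ by a positive
  -- period of at most `p`, and `period≥p` makes it equal to `p`.
  θ^p≈id : ∀ x → fold x ⟦ θ ⟧ p ≈ x
  θ^p≈id x with Fin.pigeonhole (ℕ.n<1+n p) (λ i → order.from (θ^ (toℕ i)))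
  ... | i , j , i<j , eq = trans (reflexive (≡.cong (fold x ⟦ θ ⟧) (≡.sym d≡p))) (period x)
    where
    d = toℕ j ℕ.∸ toℕ i
    instance _ = ℕ.>-nonZero (ℕ.m<n⇒0<n∸m i<j)
    same : θ^ (toℕ j) G.≈ θ^ (toℕ i)
    same x = trans (sym (order.strictlyInverseˡ (θ^ (toℕ j)) x))
      (trans (reflexive (≡.cong (λ a → ⟦ order.to a ⟧ x) (≡.sym eq)))
             (order.strictlyInverseˡ (θ^ (toℕ i)) x))
    period : ∀ x → fold x ⟦ θ ⟧ d ≈ x
    period x = fold-cancel (toℕ i) d x (trans
      (reflexive (≡.cong (fold x ⟦ θ ⟧) (ℕ.m+[n∸m]≡n (ℕ.<⇒≤ i<j)))) (same x))
    d≡p : d ≡ p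
    d≡p = ℕ.≤-antisym (ℕ.≤-trans (ℕ.m∸n≤m (toℕ j) (toℕ i)) (ℕ.s≤s⁻¹ (Fin.toℕ<n j))) (period≥p d period)

  fixed⇒rational : ∀ x → ⟦ θ ⟧ x ≈ x → ∃ λ r → x ≈ ι r
  fixed⇒rational x e = isGalois x λ τ → let (k , τ≈) = generates τ in trans (τ≈ x) (fixed k)
    where
    fixed : ∀ k → fold x ⟦ θ ⟧ k ≈ x
    fixed zero    = refl
    fixed (suc k) = trans (θ.⟦⟧-cong (fixed k)) e

  open IntegerMultiples.Conjugates commutativeRing (fromℤ K) int-hom isField _≟0 ι ι-hom (λ _ → refl)
    ⟦ θ ⟧ θ.isRingHomomorphism (fixesℚ θ) fixed⇒rational q prime θ^p≈id
    using (int-injective; sum≈S; sum-hom; dual; conjugate)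

  -- The reduced denominator is coprime to the numerator yet divides a power of it, so it is 1.
  rational∈𝓞⇒∈ℤᴷ : ∀ {α r} → α ≈ ι r → α ∈ 𝓞 K → α ∈ ℤᴷ K
  rational∈𝓞⇒∈ℤᴷ {α} {r} α≈r (d , a , root) = ↥ r , (begin
    α                              ≈⟨ *-identityˡ α ⟨
    1# * α                         ≈⟨ *-congʳ ι.1#-homo ⟨
    fromℤ K 1ℤ * α                 ≡⟨ ≡.cong (λ t → fromℤ K (+ t) * α) ↧r≡1 ⟨
    fromℤ K (↧ r) * α              ≈⟨ scaled ⟩
    fromℤ K (↥ r)                  ∎)
    where
    scaled : fromℤ K (↧ r) * α ≈ fromℤ K (↥ r)
    scaled = trans (*-congˡ α≈r) (trans (sym (ι.*-homo _ _)) (ι.⟦⟧-cong (↧*-≡↥ r)))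
    ↧r≡1 : ↧ₙ r ≡ 1
    ↧r≡1 = coprime-∣^⇒≡1 d (↧ₙ-coprime-↥ r)
      (IntegerMultiples.Integrality.denominator∣power commutativeRing (fromℤ K) int-hom int-injective
        (↧ r) (↥ r) α scaled d a root)

  module _ (α : Carrier) (α∈𝓞 : α ∈ 𝓞 K) (α∉ℤ : α ∉ ℤᴷ K) where

    α-moved : ¬ (⟦ θ ⟧ α ≈ α)
    α-moved e = let (r , α≈r) = fixed⇒rational α e in α∉ℤ (rational∈𝓞⇒∈ℤᴷ α≈r α∈𝓞)

    -- Since `d` and `p` are coprime, an element fixed by `θᵈ` and `θᵖ` is fixed by `θ`. The two
    -- cases are the two signs of a Bézout identity in natural numbers.
    no-period : ∀ d → 0 < d → d < p → ¬ (fold α ⟦ θ ⟧ d ≈ α)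
    no-period d@(suc _) 0<d d<p e with Cop.coprime-Bézout (Cop.prime⇒coprime prime d<p)
    ... | Bézout.+- x y eq = α-moved (begin
      ⟦ θ ⟧ α                            ≈⟨ θ.⟦⟧-cong (fold-period d α e y) ⟨
      fold α ⟦ θ ⟧ (1 ℕ.+ y ℕ.* d)       ≡⟨ ≡.cong (fold α ⟦ θ ⟧) eq ⟩
      fold α ⟦ θ ⟧ (x ℕ.* p)             ≈⟨ fold-period p α (θ^p≈id α) x ⟩
      α                                  ∎)
    ... | Bézout.-+ x y eq = α-moved (begin
      ⟦ θ ⟧ α                            ≈⟨ θ.⟦⟧-cong (fold-period p α (θ^p≈id α) x) ⟨
      fold α ⟦ θ ⟧ (1 ℕ.+ x ℕ.* p)       ≡⟨ ≡.cong (fold α ⟦ θ ⟧) eq ⟩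
      fold α ⟦ θ ⟧ (y ℕ.* d)             ≈⟨ fold-period d α e y ⟩
      α                                  ∎)

    conjugates-distinct : ∀ {i j} → i < j → j < p → ¬ (fold α ⟦ θ ⟧ j ≈ fold α ⟦ θ ⟧ i)
    conjugates-distinct {i} {j} i<j j<p e =
      no-period (j ℕ.∸ i) (ℕ.m<n⇒0<n∸m i<j) (ℕ.≤-<-trans (ℕ.m∸n≤m j i) j<p)
        (fold-cancel i (j ℕ.∸ i) α
          (trans (reflexive (≡.cong (fold α ⟦ θ ⟧) (ℕ.m+[n∸m]≡n (ℕ.<⇒≤ i<j)))) e))

    conjugates-injective : ∀ {i j : Fin p} →
      fold α ⟦ θ ⟧ (toℕ i) ≈ fold α ⟦ θ ⟧ (toℕ j) → i ≡ j
    conjugates-injective {i} {j} e with ℕ.<-cmp (toℕ i) (toℕ j)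
    ... | tri< i<j _ _ = ⊥-elim (conjugates-distinct i<j (Fin.toℕ<n j) (sym e))
    ... | tri≈ _ i≡j _ = Fin.toℕ-injective i≡j
    ... | tri> _ _ j<i = ⊥-elim (conjugates-distinct j<i (Fin.toℕ<n i) e)

    module _ (embedding : RealEmbedding K) where

      open RealEmbedding embedding
      private
        module φ = IsRingMonomorphism isMono
        module ℝᶜ = CommutativeRing ℝ-commutativeRing
        module ΣR = SemiringSum ℝᶜ.semiring
      open Vectors commutativeRing ℝ-commutativeRing embed φ.isRingHomomorphism p
        using (dual⇒independent; linearCombination-at; φ-sum)

      Tr≉0⇒independent : ¬ (Tr K θ α ≈ 0#) → IndependentSubset (ℝ^ p) (conjugateVectors K embedding θ α)
      Tr≉0⇒independent Tr≉0 v v∈ = dual⇒independent (conjugate α α-moved Sα≉0)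
        (proj₂ (dual α α-moved Sα≉0)) v (λ i → proj₁ (v∈ i)) (λ i → proj₂ (v∈ i))
        where
        Sα≉0 = λ e → Tr≉0 (trans (sum≈S p α) e)

      -- With trace zero, the conjugate vectors add up to zero with all coefficients 1. Independence
      -- then gives 1 = 0 in `ℝ`, which injectivity of the embedding carries back to the field.
      independent⇒Tr≉0 : IndependentSubset (ℝ^ p) (conjugateVectors K embedding θ α) → ¬ (Tr K θ α ≈ 0#)
      independent⇒Tr≉0 independent Tr≈0 = IsField.0≉1 isField (sym (φ.injective
        (ℝᶜ.trans φ.1#-homo (ℝᶜ.trans 1≈0 (ℝᶜ.sym φ.0#-homo)))))
        where
        w : Fin p → Vector ℝ p
        w j = canonicalEmbedding K embedding θ (iter K θ (toℕ j) α)
        w-injective : Injective _≡_ (LeftModule._≈ᴹ_ (ℝ^ p)) w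
        -- The coordinate at `Fin.zero` of `σ(θʲ α)` is the embedded `θʲ α` itself, so distinct
        -- conjugates give distinct vectors.
        w-injective e = conjugates-injective (φ.injective (e Fin.zero))
        Σw≈0 : ∀ k → linearCombination (ℝ^ p) (λ _ → ℝᶜ.1#) w k ℝᶜ.≈ ℝᶜ.0#
        Σw≈0 k = ℝᶜ.trans (ℝᶜ.reflexive (linearCombination-at (λ _ → ℝᶜ.1#) w k))
          (ℝᶜ.trans (ΣR.sum-cong-≋ (λ j → ℝᶜ.*-identityˡ (w j k)))
          (ℝᶜ.trans (ℝᶜ.sym (φ-sum (λ (j : Fin p) → iter K θ (toℕ k) (iter K θ (toℕ j) α))))
          (ℝᶜ.trans (φ.⟦⟧-cong Σθ^≈0) φ.0#-homo)))
          where
          -- The `k`-th coordinates add up to `θᵏ` of the trace.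
          Σθ^≈0 : sum (λ (j : Fin p) → iter K θ (toℕ k) (iter K θ (toℕ j) α)) ≈ 0#
          Σθ^≈0 = trans (sym (Vectors.φ-sum commutativeRing commutativeRing ⟦ θ^ (toℕ k) ⟧
                    (θ^.isRingHomomorphism (toℕ k)) p (λ (j : Fin p) → iter K θ (toℕ j) α)))
                  (trans (θ^.⟦⟧-cong (toℕ k) Tr≈0) (θ^.0#-homo (toℕ k)))
        1≈0 : ℝᶜ.1# ℝᶜ.≈ ℝᶜ.0#
        1≈0 = independent w (λ j → j , λ _ → ℝᶜ.refl) w-injective (λ _ → ℝᶜ.1#) Σw≈0 Fin.zero

proposition3p2 : ∀ {c ℓ : Level} (p : ℕ) → 2 < p → Prime p →
    (K : NumberField p c ℓ) → IsCyclicGalois K →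
    (θ : Gal K) → Generates K θ →
    (e : RealEmbedding K) →
    (α : NumberField.Carrier K) → α ∈ 𝓞 K → α ∉ ℤᴷ K →
    (¬ (NumberField._≈_ K (Tr K θ α) (NumberField.0# K)))
    ⇔ IndependentSubset (ℝ^ p) (conjugateVectors K e θ α)
proposition3p2 (suc (suc q)) _ p-prime K cyclic θ generates e α α∈𝓞 α∉ℤ =
  mk⇔ (Tr≉0⇒independent α α∈𝓞 α∉ℤ e) (independent⇒Tr≉0 α α∈𝓞 α∉ℤ e)
  where open CyclicField q p-prime K cyclic θ generates
proposition3p2 (suc zero) (s≤s ())
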